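{- 1. A set system $(X,\mathcal{F})$ is self-and-dual extremal if and only if it is self-and-dual well-graded, if and only if it is a full-chain system or an upward-starlike system or a downward-starlike system. 2. A set system $(X,\mathcal{F})$ is self-and-dual maximum if and only if either $|\mathcal{F}|=1$ or $\mathcal{F}=\{\emptyset,X\}$.
   Context: A set system $(X,\mathcal{F})$ is a finite set $X$ (the domain) together with a nonempty family $\mathcal{F}$ of distinct subsets of $X$. Its one-inclusion graph $G_{\mathcal{F}}$ is the edge-labelled directed graph with one vertex $v_A$ for each $A\in\mathcal{F}$ and a directed edge from $v_A$ to $v_B$ with label $b$ whenever $B=A\cup\{b\}$ for some $b\in X\setminus A$. For directed graphs, connectedness, being a tree, distances $d_G$ and degrees refer to the underlying undirected graph (infinite distance if there is no path). The system is well-graded if $|A\triangle B|=d_{G_{\mathcal{F}}}(v_A,v_B)$ for all $A,B\in\mathcal{F}$. $Y\subseteq X$ is shattered if $\mathcal{F}\cap Y:=\{A\cap Y:A\in\mathcal{F}\}$ is the full power set of $Y$; the VC-dimension is the largest size of a shattered set. $Y$ is strongly shattered if there is $T\subseteq X\setminus Y$ with $\{Z\cup T:Z\subseteq Y\}\subseteq\mathcal{F}$. The system is extremal if the shattered sets and the strongly shattered sets coincide. The system, with VC-dimension $d$, is maximum if $|\mathcal{F}\cap Y|=\sum_{i=0}^d\binom{|Y|}{i}$ for every $Y\subseteq X$. Dual system: $Y_{\mathcal{F}}=\{y_A:A\in\mathcal{F}\}$ with distinct symbols $y_A$ for distinct $A$; for $x\in X$, $\mathcal{A}_x=\{y_A:A\in\mathcal{F},\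 x\in A\}$; $\mathcal{F}^*=\{\mathcal{A}_x:x\in X\}$ (as a set, without multiplicities). The dual system of $(X,\mathcal{F})$ is $(Y_{\mathcal{F}},\mathcal{F}^*)$. A set system is called self-and-dual well-graded (respectively self-and-dual extremal, self-and-dual maximum) if both the system itself and its dual system are well-graded (respectively extremal, maximum). $(X,\mathcal{F})$ is a full-chain system if the members of $\mathcal{F}$ can be ordered as $A_1\subseteq A_2\subseteq\dots\subseteq A_n$ with $|A_i\setminus A_{i-1}|=1$ for $2\le i\le n$ (length $n\geq1$ allowed; the domain may contain elements belonging to every or to no member). In a connected directed graph $G$, a vertex $v$ is a source if every edge, directed from $w$ to $z$, satisfies $d_G(w,v)<d_G(z,v)$; it is a sink if every edge, directed from $w$ to $z$, satisfies $d_G(w,v)>d_G(z,v)$. An edge-labelled directed tree is starlike if all its edge labels are distinct and it has a distinguished vertex $v_0$ (the centre) of degree at least $2$ which is a source or a sink, while all other vertices have degree at most $2$. $(X,\mathcal{F})$ is upward-starlike if $G_{\mathcal{F}}$ is starlike, $\emptyset\in\mathcal{F}$, $v_\emptyset$ is the centre and a source of $G_{\mathcal{F}}$, and some element of $X$ belongs to no member of $\mathcal{F}$. It is downward-starlike if $G_{\mathcal{F}}$ is starlike, $X\in\mathcal{F}$, $v_X$ is the centre and a sink of $G_{\mathcal{F}}$, and some element of $X$ belongs to every member of $\mathcal{F}$.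
   Formalization: In part 2 the alternative F = {∅, X} is stated only for |X| = 1, since for |X| ≥ 2 the system {∅, X} has VC-dimension 1 but only 2 < 1 + |X| members, so it is not maximum. -}

module Defs where

open import Data.Bool.Properties using () renaming (_≟_ to _≟ᵇ_)
open import Data.Fin.Base using (Fin)
open import Data.Fin.Properties using (any?)
open import Data.Fin.Subset
  using (Subset; _∈_; _∉_; _⊆_; _∩_; _∪_; _─_; ∁; ⁅_⁆; ∣_∣; ⊥; ⊤)
open import Data.Fin.Subset.Properties using (_∈?_)
open import Data.List.Base
  using (List; []; _∷_; _∷ʳ_; allFin; deduplicate; filter; length; lookup; map; tabulate; upTo)
open import Data.List.Membership.Propositional using () renaming (_∈_ to _∈ˡ_)
open import Data.List.Relation.Binary.Permutation.Propositional using (_↭_)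
open import Data.List.Relation.Unary.Linked using (Linked)
open import Data.List.Relation.Unary.Unique.Propositional using (Unique)
open import Data.List.Relation.Unary.Unique.DecPropositional.Properties using (deduplicate-!)
open import Data.Nat.Base using (ℕ; zero; suc; _≤_; _<_)
open import Data.Nat.ListAction using (sum)
open import Data.Nat.Combinatorics using (_C_)
open import Data.Product.Base using (_×_; ∃; ∃₂; ∃-syntax)
open import Data.Sum.Base using (_⊎_)
import Data.Vec.Base as Vec
open import Data.Vec.Properties using (≡-dec)
open import Function.Bundles using (_⇔_)
open import Relation.Binary.Definitions using (DecidableEquality)
open import Relation.Binary.PropositionalEquality using (_≡_; _≢_)
open import Relation.Nullary using (¬_; Dec; ¬?; _×-dec_; _⊎-dec_)

private
  variable
    m n : ℕ

------------------------------------------------------------------------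
-- Set systems

_≟ˢ_ : DecidableEquality (Subset n)
_≟ˢ_ = ≡-dec _≟ᵇ_

-- The domain is Fin n.  The order of the list of members carries no
-- meaning; it only serves to index the vertices of the one-inclusion
-- graph and the points of the dual domain.  Nonemptiness is kept
-- separate because the dual of a system on the empty domain has no
-- members.
record Family (n : ℕ) : Set where
  field
    members  : List (Subset n)
    distinct : Unique members

  size : ℕ
  size = length members

  member : Fin size → Subset n
  member = lookup members

open Family public

NonEmpty : Family n → Set
NonEmpty F = members F ≢ []

infix 4 _∈ᶠ_

_∈ᶠ_ : Subset n → Family n → Set
A ∈ᶠ F = A ∈ˡ members F

fromList : List (Subset n) → Family n
fromList As = record
  { members  = deduplicate _≟ˢ_ As
  ; distinct = deduplicate-! _≟ˢ_ As
  }

-- The trace F ∩ Y, kept as a family on the whole domain.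
trace : Family n → Subset n → Family n
trace F Y = fromList (map (_∩ Y) (members F))

-- The index i : Fin (size F) plays the role of the symbol y_A for
-- A = member F i.
dualSet : (F : Family n) → Fin n → Subset (size F)
dualSet F x = Vec.tabulate (λ i → Vec.lookup (member F i) x)

dual : (F : Family n) → Family (size F)
dual F = fromList (tabulate (dualSet F))

SelfAndDual : (∀ {k} → Family k → Set) → Family n → Set
SelfAndDual P F = P F × P (dual F)

------------------------------------------------------------------------
-- Edge-labelled directed graphs, with vertices Fin m and labels Fin n

record Digraph (m n : ℕ) : Set₁ where
  field
    Arc  : Fin m → Fin n → Fin m → Set
    arc? : ∀ u b v → Dec (Arc u b v)

  Adj : Fin m → Fin m → Set
  Adj u v = ∃[ b ] (Arc u b v ⊎ Arc v b u)

  adj? : ∀ u v → Dec (Adj u v)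
  adj? u v = any? (λ b → arc? u b v ⊎-dec arc? v b u)

  data Walk : Fin m → Fin m → ℕ → Set where
    nil  : ∀ {u} → Walk u u zero
    cons : ∀ {u v w k} → Adj u v → Walk v w k → Walk u w (suc k)

  -- No k satisfies this when v is unreachable from u, that is, when the
  -- distance is infinite.
  Distance : Fin m → Fin m → ℕ → Set
  Distance u v k = Walk u v k × (∀ l → Walk u v l → k ≤ l)

  -- The number of neighbours; this is the number of incident edges since
  -- one-inclusion graphs have no loops and no parallel or opposite edges.
  degree : Fin m → ℕ
  degree v = length (filter (adj? v) (allFin m))

  Connected : Set
  Connected = ∀ u v → ∃ (Walk u v)

  Cycle : Fin m → List (Fin m) → Set
  Cycle u vs = Linked Adj (u ∷ vs ∷ʳ u) × Unique (u ∷ vs) × 2 ≤ length vs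

  Tree : Set
  Tree = Connected × (∀ u vs → ¬ Cycle u vs)

  Source : Fin m → Set
  Source v = ∀ w b z → Arc w b z →
    ∃₂ λ d e → Distance w v d × Distance z v e × d < e

  Sink : Fin m → Set
  Sink v = ∀ w b z → Arc w b z →
    ∃₂ λ d e → Distance w v d × Distance z v e × e < d

  DistinctLabels : Set
  DistinctLabels = ∀ {u v u′ v′} b → Arc u b v → Arc u′ b v′ → u ≡ u′ × v ≡ v′

  StarlikeWithCentre : Fin m → Set
  StarlikeWithCentre v₀ =
    Tree × DistinctLabels × 2 ≤ degree v₀ × (Source v₀ ⊎ Sink v₀) ×
    (∀ v → v ≢ v₀ → degree v ≤ 2)

oneInclusion : (F : Family n) → Digraph (size F) n
oneInclusion F = record
  { Arc  = λ i b j → b ∉ member F i × member F j ≡ member F i ∪ ⁅ b ⁆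
  ; arc? = λ i b j → ¬? (b ∈? member F i) ×-dec (member F j ≟ˢ (member F i ∪ ⁅ b ⁆))
  }

------------------------------------------------------------------------
-- Well-graded, extremal and maximum systems

_△_ : Subset n → Subset n → Subset n
A △ B = (A ─ B) ∪ (B ─ A)

WellGraded : Family n → Set
WellGraded F = ∀ i j → Distance i j ∣ member F i △ member F j ∣
  where open Digraph (oneInclusion F)

Shattered : Family n → Subset n → Set
Shattered F Y = ∀ Z → Z ∈ᶠ trace F Y ⇔ Z ⊆ Y

StronglyShattered : Family n → Subset n → Set
StronglyShattered F Y = ∃[ T ] (T ⊆ ∁ Y × (∀ Z → Z ⊆ Y → (Z ∪ T) ∈ᶠ F))

Extremal : Family n → Set
Extremal F = ∀ Y → Shattered F Y ⇔ StronglyShattered F Y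

HasVCDim : Family n → ℕ → Set
HasVCDim F d =
  (∃[ Y ] (Shattered F Y × ∣ Y ∣ ≡ d)) × (∀ Y → Shattered F Y → ∣ Y ∣ ≤ d)

-- A nonempty family has exactly one VC-dimension.  The empty family
-- shatters nothing, so it has none and counts as maximum (the binomial
-- sum being empty under the usual convention d = -1).
Maximum : Family n → Set
Maximum F = ∀ d → HasVCDim F d →
  ∀ Y → size (trace F Y) ≡ sum (map (∣ Y ∣ C_) (upTo (suc d)))

------------------------------------------------------------------------
-- Full chains and stars

FullChain : Family n → Set
FullChain F = ∃[ As ]
  (As ↭ members F × Linked (λ A B → A ⊆ B × ∣ B ─ A ∣ ≡ 1) As)

UpwardStarlike : Family n → Set
UpwardStarlike F =
  (∃[ i ] (member F i ≡ ⊥ × StarlikeWithCentre i × Source i)) ×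
  (∃[ x ] (∀ A → A ∈ᶠ F → x ∉ A))
  where open Digraph (oneInclusion F)

DownwardStarlike : Family n → Set
DownwardStarlike F =
  (∃[ i ] (member F i ≡ ⊤ × StarlikeWithCentre i × Sink i)) ×
  (∃[ x ] (∀ A → A ∈ᶠ F → x ∈ A))
  where open Digraph (oneInclusion F)

-- F = {∅, X}.  Such a family is not maximum when the domain has at least
-- two elements: it has VC-dimension 1 and size 2 < 1 + n.
IsEmptyAndFull : Family n → Set
IsEmptyAndFull F = ∀ A → A ∈ᶠ F ⇔ (A ≡ ⊥ ⊎ A ≡ ⊤)

{-# OPTIONS --safe #-}
module Submission where

open import Defs
open import Data.Bool.Base using (Bool; true; false; not; _∧_; _∨_; _xor_; if_then_else_)
open import Data.Bool.Properties
  using (¬-not; not-injective; not-involutive; ∨-identityʳ; ∨-zeroʳ; ∧-identityʳ; ∧-zeroʳ)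
  renaming (_≟_ to _≟ᵇ_)
open import Data.Fin.Base using (Fin; zero; suc)
open import Data.Fin.Properties using (any?; all?; injective⇒≤; suc-injective; ¬∀⟶∃¬)
  renaming (_≟_ to _≟ᶠ_)
open import Data.Fin.Subset using (Subset; _∈_; _∉_; _⊆_; _∩_; _∪_; _─_; ∁; ⁅_⁆; ∣_∣; ⊥; ⊤)
open import Data.Fin.Subset.Properties
  using (_∈?_; _⊆?_; anySubset?; ⊆-antisym; ⊆-trans; ⊆-refl; ⊆-min; drop-∷-⊆; p⊂q⇒∣p∣<∣q∣;
         p∩q⊆q; ∩-identityʳ; ∩-zeroʳ; x∈⁅x⁆; x∈⁅y⁆⇒x≡y; x≢y⇒x∉⁅y⁆; x∉p⇒x∈∁p; x∈∁p⇒x∉p;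
         ∣p∣≤n; ∣⊥∣≡0; ∣⊤∣≡n; ∣⁅x⁆∣≡1)
open import Data.List.Base as List
  using (List; []; _∷_; _∷ʳ_; allFin; filter; length; map; tabulate; upTo)
open import Data.List.Membership.DecPropositional using () renaming (_∈?_ to ∈ˡ?)
open import Data.List.Membership.Propositional using () renaming (_∈_ to _∈ˡ_)
open import Data.List.Membership.Propositional.Properties
  using (∈-lookup; ∈-allFin; ∈-filter⁺; ∈-filter⁻; ∈-tabulate⁺; ∈-tabulate⁻; ∈-map⁺; ∈-map⁻;
         ∈-deduplicate⁺; ∈-deduplicate⁻)
open import Data.List.Properties using (length-tabulate)
open import Data.List.Relation.Binary.Permutation.Propositional using (_↭_; ↭-sym; ↭⇒↭ₛ)
open import Data.List.Relation.Binary.Permutation.Propositional.Properties using (∈-resp-↭)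
open import Data.List.Relation.Binary.Permutation.Setoid.Properties using (AllPairs-resp-↭)
open import Data.List.Relation.Unary.All as All using (All; []; _∷_)
open import Data.List.Relation.Unary.AllPairs as AllPairs using (AllPairs; []; _∷_)
open import Data.List.Relation.Unary.Any using (here; there; index)
open import Data.List.Relation.Unary.Any.Properties using (lookup-index)
open import Data.List.Relation.Unary.Linked as Linked using (Linked; []; [-]; _∷_)
open import Data.List.Relation.Unary.Linked.Properties using (Linked⇒AllPairs)
open import Data.List.Relation.Unary.Unique.Propositional using (Unique)
open import Data.List.Relation.Unary.Unique.Propositional.Properties using (allFin⁺; filter⁺)
import Data.List.Sort as Sort
open import Data.Nat.Base using (ℕ; zero; suc; _+_; _≤_; _<_; z≤n; s≤s; s≤s⁻¹)
open import Data.Nat.Combinatorics using (_C_; nC1≡n)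
open import Data.Nat.ListAction using (sum)
open import Data.Nat.Properties as ℕ using (+-suc)
open import Data.Product.Base using (Σ; _×_; _,_; proj₁; proj₂; ∃; ∃₂)
open import Data.Sum.Base using (_⊎_; inj₁; inj₂; reduce)
open import Data.Vec.Base as Vec using (_∷_; [])
open import Data.Vec.Functional using (updateAt)
open import Data.Vec.Functional.Properties using (updateAt-updates; updateAt-minimal)
open import Data.Vec.Properties
  using (lookup⇒[]=; []=⇒lookup; lookup-zipWith; lookup-replicate; lookup∘tabulate;
         tabulate∘lookup; tabulate-cong)
open import Function.Base using (_∘_; const)
open import Function.Bundles using (_⇔_; mk⇔; Equivalence)
open import Relation.Binary.Construct.On using () renaming (decTotalOrder to on-decTotalOrder)
open import Relation.Binary.PropositionalEquality
  using (_≡_; _≢_; _≗_; refl; sym; trans; cong; cong₂; subst; ≢-sym; resp₂; setoid)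
open import Relation.Nullary using (¬_; Dec; yes; no; does; ¬?; _×-dec_; contradiction)
open import Relation.Nullary.Decidable using (decidable-stable; dec-true; dec-false)

-- Both systems are read off the 0/1 incidence matrix: its rows are the
-- members of F, and its columns are the members of the dual.  A system is
-- well-graded iff from any row one can move towards any only-⊤ by changing
-- one entry.  Towards a root row r this gives every only-⊤ row a label, and
-- every nonconstant column is a label; likewise for columns towards a root
-- column.  Composing the two labellings maps the rows onto themselves, hence
-- bijectively, so that all edges of the row tree carry distinct labels.  This
-- forces a constant row or column to exist and makes rows and columns, up to
-- complementation, laminar (if both kinds of constant columns or rows occur,
-- even a chain), which is the chain-or-star shape.  In particular no pair is
-- shattered on either side, so both systems are extremal; conversely every
-- extremal system is well-graded because its faces are extremal.
--
-- A maximum system of positive VC-dimension has at least 1 + n members; if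
-- the dual had positive VC-dimension as well, then n ≥ 1 + (1 + n).

-- The dual forgets repeated columns, so an argument symmetric in rows and columns cannot run on the
-- incidence matrix of `F` itself. It runs on `dualMatrix F`, where repetitions are merged and both
-- rows and columns are distinct; `SameColumns` carries the resulting shape back. Phrasing
-- everything for matrices makes transposition (duality) and complementation available as
-- symmetries: downward stars become upward stars of the complement. A labelling towards a root
-- leaves the label of the root itself free. The two labellings compose to a self-map of all rows
-- only once this value is chosen, and the counting depends on the choice. The constant columns
-- decide the case. If an empty and a full column exist, the rows form a chain. If only one kind
-- exists, there is a constant row of the same kind. If there is none, constant rows of both kinds
-- must exist, and the transpose is a chain.

private
  variable
    m n : ℕ

-- Boolean functions and finite surjections

≢∧≢⇒≡ : ∀ {a b c : Bool} → a ≢ b → b ≢ c → a ≡ c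
≢∧≢⇒≡ a≢b b≢c = trans (¬-not a≢b) (sym (¬-not (≢-sym b≢c)))

true≢false : true ≢ false
true≢false ()

≢true⇒≡false : ∀ {a} → a ≢ true → a ≡ false
≢true⇒≡false = ¬-not

≢false⇒≡true : ∀ {a} → a ≢ false → a ≡ true
≢false⇒≡true = ¬-not

≗⊎≢ : (f g : Fin n → Bool) → f ≗ g ⊎ ∃ λ x → f x ≢ g x
≗⊎≢ f g with any? (λ x → ¬? (f x ≟ᵇ g x))
... | yes differ = inj₂ differ
... | no  agree  = inj₁ λ x → decidable-stable (f x ≟ᵇ g x) (λ fx≢gx → agree (x , fx≢gx))

⊆⊎⊈ : (f g : Fin n → Bool) →
      (∀ x → f x ≡ true → g x ≡ true) ⊎ ∃ λ x → f x ≡ true × g x ≡ false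
⊆⊎⊈ f g with any? (λ x → (f x ≟ᵇ true) ×-dec (g x ≟ᵇ false))
... | yes (x , fx , gx) = inj₂ (x , fx , gx)
... | no  ⊆ = inj₁ λ x fx → ≢false⇒≡true λ gx → ⊆ (x , fx , gx)

-- A section `g` of `f` is injective. If it were not also a left inverse, it would miss some `k`,
-- and adjoining `k` as a further value would inject `Fin (suc m)` into `Fin m`.
onto⇒injective : (f : Fin m → Fin m) → (∀ j → ∃ λ i → f i ≡ j) →
                 ∀ {i j} → f i ≡ f j → i ≡ j
onto⇒injective {m} f onto {i} {j} fi≡fj = trans (sym (retract i)) (trans (cong g fi≡fj) (retract j))
  where
  g : Fin m → Fin m
  g = proj₁ ∘ onto

  section : ∀ k → f (g k) ≡ k
  section = proj₂ ∘ onto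

  retract : ∀ k → g (f k) ≡ k
  retract k with g (f k) ≟ᶠ k
  ... | yes eq = eq
  ... | no gfk≢k = contradiction (injective⇒≤ extended-injective) ℕ.1+n≰n
    where
    missed : ∀ l → g l ≢ k
    missed l gl≡k = gfk≢k (trans (cong g (trans (cong f (sym gl≡k)) (section l))) gl≡k)

    extended : Fin (suc m) → Fin m
    extended zero    = k
    extended (suc l) = g l

    extended-injective : ∀ {a b} → extended a ≡ extended b → a ≡ b
    extended-injective {zero}  {zero}  _  = refl
    extended-injective {zero}  {suc b} eq = contradiction (sym eq) (missed b)
    extended-injective {suc a} {zero}  eq = contradiction eq (missed a)
    extended-injective {suc a} {suc b} eq =
      cong suc (trans (sym (section a)) (trans (cong f eq) (section b)))

-- Hamming distance

bit : Bool → ℕ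
bit true  = 1
bit false = 0

hamming : (f g : Fin n → Bool) → ℕ
hamming {zero}  f g = 0
hamming {suc n} f g = bit (f zero xor g zero) + hamming (f ∘ suc) (g ∘ suc)

-- An edge of the one-inclusion graph with its label but without its direction, so that
-- complementation preserves it.
FlipAt : (Fin n → Bool) → Fin n → (Fin n → Bool) → Set
FlipAt f b g = f b ≢ g b × (∀ c → c ≢ b → f c ≡ g c)

flipAt-sym : {f g : Fin n → Bool} {b : Fin n} → FlipAt f b g → FlipAt g b f
flipAt-sym (differ , agree) = ≢-sym differ , λ c c≢b → sym (agree c c≢b)

xor-≢ : ∀ {a b} → a ≢ b → a xor b ≡ true
xor-≢ {true}  {true}  a≢b = contradiction refl a≢b
xor-≢ {true}  {false} _   = refl
xor-≢ {false} {true}  _   = refl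
xor-≢ {false} {false} a≢b = contradiction refl a≢b

xor-≡ : ∀ {a b} → a ≡ b → a xor b ≡ false
xor-≡ {true}  refl = refl
xor-≡ {false} refl = refl

hamming-cong : {f f′ g g′ : Fin n → Bool} → f ≗ f′ → g ≗ g′ → hamming f g ≡ hamming f′ g′
hamming-cong {zero}  _   _   = refl
hamming-cong {suc n} eq eq′ =
  cong₂ _+_ (cong bit (cong₂ _xor_ (eq zero) (eq′ zero))) (hamming-cong (eq ∘ suc) (eq′ ∘ suc))

hamming-flip : {f g h : Fin n → Bool} {b : Fin n} →
               FlipAt f b g → f b ≢ h b → hamming f h ≡ suc (hamming g h)
hamming-flip {f = f} {g} {h} {zero} (fb≢gb , agree) fb≢hb
  rewrite xor-≢ fb≢hb | xor-≡ (≢∧≢⇒≡ (≢-sym fb≢gb) fb≢hb) =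
  cong suc (hamming-cong (λ c → agree (suc c) λ ()) (λ _ → refl))
hamming-flip {f = f} {g} {h} {suc b} (fb≢gb , agree) fb≢hb
  rewrite agree zero (λ ())
        | hamming-flip {f = f ∘ suc} {g ∘ suc} {h ∘ suc} {b}
            (fb≢gb , λ c c≢b → agree (suc c) (c≢b ∘ suc-injective)) fb≢hb =
  +-suc (bit (g zero xor h zero)) _

hamming-flip-≤ : {f g h : Fin n → Bool} {b : Fin n} →
                 FlipAt f b g → hamming f h ≤ suc (hamming g h)
hamming-flip-≤ {f = f} {h = h} {b} flip with f b ≟ᵇ h b
... | no fb≢hb = ℕ.≤-reflexive (hamming-flip flip fb≢hb)
... | yes fb≡hb =
  ℕ.m≤n⇒m≤1+n (ℕ.≤-trans (ℕ.n≤1+n _) (ℕ.≤-reflexive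
    (sym (hamming-flip (flipAt-sym flip) λ gb≡hb → proj₁ flip (trans fb≡hb (sym gb≡hb))))))

hamming-≢ : (f g : Fin n → Bool) (x : Fin n) → f x ≢ g x → hamming f g ≢ 0
hamming-≢ f g zero    fx≢gx eq rewrite xor-≢ fx≢gx with () ← eq
hamming-≢ f g (suc x) fx≢gx eq =
  hamming-≢ (f ∘ suc) (g ∘ suc) x fx≢gx (ℕ.m+n≡0⇒n≡0 (bit (f zero xor g zero)) eq)

hamming-≗ : {f g : Fin n → Bool} → f ≗ g → hamming f g ≡ 0
hamming-≗ {zero}  eq = refl
hamming-≗ {suc n} eq rewrite xor-≡ (eq zero) = hamming-≗ (eq ∘ suc)

-- Over the Booleans the hypothesis places `g` in the interval between `f` and `h`.
hamming-between : {f g h : Fin n → Bool} → (∀ x → f x ≡ h x → f x ≡ g x) →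
                  hamming f g ≤ hamming f h
hamming-between {zero}  _ = z≤n
hamming-between {suc n} {f} {g} {h} between with f zero ≟ᵇ h zero
... | yes eq rewrite xor-≡ eq | xor-≡ (between zero eq) = hamming-between (between ∘ suc)
... | no neq rewrite xor-≢ neq =
  ℕ.+-mono-≤ (bit≤1 (f zero xor g zero)) (hamming-between (between ∘ suc))
  where
  bit≤1 : ∀ a → bit a ≤ 1
  bit≤1 true  = s≤s z≤n
  bit≤1 false = z≤n

hamming-strictly-between : {f g h : Fin n → Bool} {y : Fin n} → (∀ x → f x ≡ h x → f x ≡ g x) →
                           f y ≢ h y → f y ≡ g y → hamming f g < hamming f h
hamming-strictly-between {f = f} {g} {h} {zero} between fy≢hy fy≡gy
  rewrite xor-≢ fy≢hy | xor-≡ fy≡gy = s≤s (hamming-between (between ∘ suc))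
hamming-strictly-between {f = f} {g} {h} {suc y} between fy≢hy fy≡gy with f zero ≟ᵇ h zero
... | yes eq rewrite xor-≡ eq | xor-≡ (between zero eq) =
  hamming-strictly-between (between ∘ suc) fy≢hy fy≡gy
... | no neq rewrite xor-≢ neq with f zero xor g zero
...   | true  = s≤s (hamming-strictly-between (between ∘ suc) fy≢hy fy≡gy)
...   | false = ℕ.m≤n⇒m≤1+n (hamming-strictly-between (between ∘ suc) fy≢hy fy≡gy)

-- Matrices

Matrix : ℕ → ℕ → Set
Matrix m n = Fin m → Fin n → Bool

infix 8 _ᵀ

_ᵀ : Matrix m n → Matrix n m
(P ᵀ) x i = P i x

complement : Matrix m n → Matrix m n
complement P i x = not (P i x)

DistinctRows : Matrix m n → Set
DistinctRows P = ∀ i j → P i ≗ P j → i ≡ j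

-- Only the first step of a shortest path; iterating it gives the whole path. `x` witnesses that the
-- rows differ, while the step may flip another coordinate `b`.
Geodesic : Matrix m n → Set
Geodesic P = ∀ i j x → P i x ≢ P j x →
  ∃₂ λ k b → FlipAt (P i) b (P k) × P i b ≢ P j b

LaminarColumns : Matrix m n → Set
LaminarColumns P = ∀ i x y → P i x ≡ true → P i y ≡ true →
  (∀ k → P k x ≡ true → P k y ≡ true) ⊎ (∀ k → P k y ≡ true → P k x ≡ true)

ChainOfRows : Matrix m n → Set
ChainOfRows P = ∀ i j →
  (∀ x → P i x ≡ true → P j x ≡ true) ⊎ (∀ x → P j x ≡ true → P i x ≡ true)

-- On the way from `i` to `j` the coordinate `x` has to change at some step, and that step is an
-- edge labelled `x`.
geodesic⇒edge : {P : Matrix m n} → Geodesic P → ∀ i j x → P i x ≢ P j x →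
                ∃₂ λ k l → FlipAt (P k) x (P l)
geodesic⇒edge {P = P} geodesic i j x = go _ i refl
  where
  go : ∀ d i → hamming (P i) (P j) ≡ d → P i x ≢ P j x → ∃₂ λ k l → FlipAt (P k) x (P l)
  go zero i eq differ = contradiction eq (hamming-≢ (P i) (P j) x differ)
  go (suc d) i eq differ with geodesic i j x differ
  ... | k , b , flip , toward with b ≟ᶠ x
  ...   | yes refl = i , k , flip
  ...   | no b≢x = go d k (ℕ.suc-injective (trans (sym (hamming-flip flip toward)) eq))
                     (λ kx≡jx → differ (trans (proj₂ flip x (≢-sym b≢x)) kx≡jx))

-- Trees of rows

record Descent (P : Matrix m n) (root : Fin m) : Set where
  field
    label  : Fin m → Fin n
    parent : Fin m → Fin m
    flip   : ∀ {i} → i ≢ root → FlipAt (P i) (label i) (P (parent i))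
    toward : ∀ {i} → i ≢ root → P i (label i) ≢ P root (label i)

  closer : ∀ {i} → i ≢ root → hamming (P i) (P root) ≡ suc (hamming (P (parent i)) (P root))
  closer i≢root = hamming-flip (flip i≢root) (toward i≢root)

  -- Following parents from `i`, the entry at `x` must at some point take the value of the root; the
  -- row at which this happens has label `x`.
  label-onto : ∀ i x → P i x ≢ P root x → ∃ λ j → j ≢ root × label j ≡ x
  label-onto i x = go _ i refl
    where
    go : ∀ d i → hamming (P i) (P root) ≡ d → P i x ≢ P root x → ∃ λ j → j ≢ root × label j ≡ x
    go zero i eq differ = contradiction eq (hamming-≢ (P i) (P root) x differ)
    go (suc d) i eq differ with label i ≟ᶠ x
    ... | yes label≡x = i , (λ { refl → differ refl }) , label≡x
    ... | no label≢x =
      go d (parent i) (ℕ.suc-injective (trans (sym (closer i≢root)) eq))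
         (λ eq′ → differ (trans (proj₂ (flip i≢root) x (≢-sym label≢x)) eq′))
      where
      i≢root : i ≢ root
      i≢root refl = differ refl

-- The value of the label at the root is junk; the counting arguments
-- choose it.
descent : {P : Matrix m n} → Geodesic P → DistinctRows P → ∀ root z →
          Σ (Descent P root) λ D → Descent.label D root ≡ z
descent {m} {n} {P} geodesic distinct root z = record
  { label  = λ i → proj₁ (step i)
  ; parent = λ i → proj₁ (proj₂ (step i))
  ; flip   = λ i≢root → proj₁ (proj₁ (proj₂ (proj₂ (step _))) i≢root)
  ; toward = λ i≢root → proj₂ (proj₁ (proj₂ (proj₂ (step _))) i≢root)
  } , proj₂ (proj₂ (proj₂ (step root))) refl
  where
  step : ∀ i → ∃₂ λ b k → (i ≢ root → FlipAt (P i) b (P k) × P i b ≢ P root b) × (i ≡ root → b ≡ z)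
  step i with i ≟ᶠ root
  ... | yes i≡root = z , root , contradiction i≡root , λ _ → refl
  ... | no i≢root with ≗⊎≢ (P i) (P root)
  ...   | inj₁ same = contradiction (distinct i root same) i≢root
  ...   | inj₂ (x , differ) with geodesic i root x differ
  ...     | k , b , f , t = b , k , (λ _ → f , t) , λ i≡root → contradiction i≡root i≢root

InjectiveLabels : {P : Matrix m n} {root : Fin m} → Descent P root → Set
InjectiveLabels {root = root} D =
  ∀ {i j} → i ≢ root → j ≢ root → Descent.label D i ≡ Descent.label D j → i ≡ j

-- A descent with injective labels to the empty row makes the rows a
-- rooted tree whose edges carry distinct labels.
module LabelledTree {P : Matrix m n} {root : Fin m} (empty : ∀ x → P root x ≡ false)
                    (D : Descent P root) (injective : InjectiveLabels D) where
  open Descent D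

  nonroot : ∀ {i x} → P i x ≡ true → i ≢ root
  nonroot {x = x} ix refl = true≢false (trans (sym ix) (empty x))

  label∈ : ∀ {i} → i ≢ root → P i (label i) ≡ true
  label∈ {i} i≢root = ≢false⇒≡true λ eq → toward i≢root (trans eq (sym (empty (label i))))

  label∉parent : ∀ {i} → i ≢ root → P (parent i) (label i) ≡ false
  label∉parent i≢root =
    ≢true⇒≡false λ eq → proj₁ (flip i≢root) (trans (label∈ i≢root) (sym eq))

  ∈parent : ∀ {i x} → P i x ≡ true → x ≢ label i → P (parent i) x ≡ true
  ∈parent ix x≢label = trans (sym (proj₂ (flip (nonroot ix)) _ x≢label)) ix

  parent⊆ : ∀ {i x} → i ≢ root → P (parent i) x ≡ true → P i x ≡ true
  parent⊆ {i} {x} i≢root px with x ≟ᶠ label i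
  ... | yes refl = label∈ i≢root
  ... | no x≢label = trans (proj₂ (flip i≢root) x x≢label) px

  -- Well-founded because passing to the parent lowers the Hamming distance to the root by one.
  row-induction : (Q : Fin m → Set) →
                  (∀ i → (i ≢ root → Q (parent i)) → Q i) → ∀ i → Q i
  row-induction Q rec i = go _ i refl
    where
    go : ∀ d i → hamming (P i) (P root) ≡ d → Q i
    go zero i eq = rec i λ i≢root → contradiction (trans (sym (closer i≢root)) eq) λ ()
    go (suc d) i eq =
      rec i λ i≢root → go d (parent i) (ℕ.suc-injective (trans (sym (closer i≢root)) eq))

  -- On the way from `i` to the root the element `label j` is lost only at a row with that label,
  -- which by injectivity is `j`. So `j` is an ancestor of `i`, and rows only shrink towards the
  -- root.
  label∈⇒⊆ : ∀ {j} → j ≢ root → ∀ i → P i (label j) ≡ true →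
             ∀ y → P j y ≡ true → P i y ≡ true
  label∈⇒⊆ {j} j≢root = row-induction _ λ i rec i∋label y jy →
    let i≢root = nonroot i∋label in
    case-label i i≢root rec i∋label y jy (label i ≟ᶠ label j)
    where
    case-label : ∀ i → i ≢ root →
      (i ≢ root → P (parent i) (label j) ≡ true → ∀ y → P j y ≡ true → P (parent i) y ≡ true) →
      P i (label j) ≡ true → ∀ y → P j y ≡ true → Dec (label i ≡ label j) → P i y ≡ true
    case-label i i≢root rec i∋label y jy (yes same) =
      subst (λ k → P k y ≡ true) (sym (injective i≢root j≢root same)) jy
    case-label i i≢root rec i∋label y jy (no differ) =
      parent⊆ i≢root (rec i≢root (∈parent i∋label (≢-sym differ)) y jy)

  -- Descend from a common row until `x` or `y` is the label. If it is `x`, that row still contains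
  -- `y` and is contained in every row with `x`.
  laminar : LaminarColumns P
  laminar i x y = row-induction
    (λ i → P i x ≡ true → P i y ≡ true →
      (∀ k → P k x ≡ true → P k y ≡ true) ⊎ (∀ k → P k y ≡ true → P k x ≡ true))
    step i
    where
    step : ∀ i → _ → P i x ≡ true → P i y ≡ true → _
    step i rec ix iy with x ≟ᶠ label i | y ≟ᶠ label i
    ... | yes refl | _ = inj₁ λ k kx → label∈⇒⊆ (nonroot ix) k kx y iy
    ... | no _ | yes refl = inj₂ λ k ky → label∈⇒⊆ (nonroot ix) k ky x ix
    ... | no x≢ | no y≢ = rec (nonroot ix) (∈parent ix x≢) (∈parent iy y≢)

  -- If `i` is not inside `j`, the step to the parent of `i` works, since a `j` with the label of
  -- `i` would contain `i`. Otherwise `i` is an ancestor of `j`, and `up` descends from `j` to the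
  -- child of `i` on that branch.
  geodesic : Geodesic P
  geodesic i j x ix≢jx with ⊆⊎⊈ (P i) (P j)
  ... | inj₂ (y , iy , jy) = parent i , label i , flip i≢root ,
    λ eq → true≢false (trans (sym (label∈⇒⊆ i≢root j (trans (sym eq) (label∈ i≢root)) y iy)) jy)
    where i≢root = nonroot iy
  ... | inj₁ i⊆j = up j i⊆j x ix≢jx
    where
    outside : ∀ {k} → (∀ y → P i y ≡ true → P k y ≡ true) → ∀ y → P i y ≢ P k y →
              P i y ≡ false × P k y ≡ true
    outside {k} i⊆k y differ with P i y in iy
    ... | false = refl , ≢false⇒≡true (≢-sym differ)
    ... | true  = contradiction (sym (i⊆k y iy)) differ

    up : ∀ k → (∀ y → P i y ≡ true → P k y ≡ true) → ∀ y → P i y ≢ P k y →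
         ∃₂ λ l b → FlipAt (P i) b (P l) × P i b ≢ P k b
    up = row-induction _ step
      where
      step : ∀ k → (k ≢ root → (∀ y → P i y ≡ true → P (parent k) y ≡ true) →
                     ∀ y → P i y ≢ P (parent k) y →
                     ∃₂ λ l b → FlipAt (P i) b (P l) × P i b ≢ P (parent k) b) →
             (∀ y → P i y ≡ true → P k y ≡ true) → ∀ y → P i y ≢ P k y →
             ∃₂ λ l b → FlipAt (P i) b (P l) × P i b ≢ P k b
      step k rec i⊆k y differ = continue (≗⊎≢ (P i) (P (parent k)))
        where
        iy : P i y ≡ false
        iy = proj₁ (outside i⊆k y differ)

        ky : P k y ≡ true
        ky = proj₂ (outside i⊆k y differ)

        k≢root : k ≢ root
        k≢root = nonroot ky

        i⊆parent : ∀ w → P i w ≡ true → P (parent k) w ≡ true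
        i⊆parent w iw = label∈⇒⊆ i≢root (parent k)
          (∈parent (i⊆k _ (label∈ i≢root)) (λ same → i≢k (injective i≢root k≢root same))) w iw
          where
          i≢root = nonroot iw
          i≢k : i ≢ k
          i≢k refl = differ refl

        continue : P i ≗ P (parent k) ⊎ (∃ λ w → P i w ≢ P (parent k) w) →
                   ∃₂ λ l b → FlipAt (P i) b (P l) × P i b ≢ P k b
        continue (inj₁ same) with flip k≢root
        ... | change , agree = k , label k ,
          ((λ eq → change (trans (sym eq) (same (label k)))) ,
            λ c c≢b → trans (same c) (sym (agree c c≢b))) ,
          λ eq → change (trans (sym eq) (same (label k)))
        continue (inj₂ (w , differ′)) with rec k≢root i⊆parent w differ′
        ... | l , b , f , toward′ with outside i⊆parent b toward′
        ...   | ib , pb = l , b , f ,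
          λ eq → true≢false (trans (sym (parent⊆ k≢root pb)) (trans (sym eq) ib))

-- Two incomparable rows form, with the two witnessing columns, a permutation matrix of order two,
-- and this obstruction is invariant under transposition.
chainOfRows-ᵀ : {P : Matrix m n} → ChainOfRows (P ᵀ) → ChainOfRows P
chainOfRows-ᵀ {P = P} chain i j with ⊆⊎⊈ (P i) (P j) | ⊆⊎⊈ (P j) (P i)
... | inj₁ i⊆j | _ = inj₁ i⊆j
... | inj₂ _ | inj₁ j⊆i = inj₂ j⊆i
... | inj₂ (x , ix , jx) | inj₂ (y , jy , iy) with chain x y
...   | inj₁ x⊆y = contradiction (trans (sym (x⊆y i ix)) iy) true≢false
...   | inj₂ y⊆x = contradiction (trans (sym (y⊆x j jy)) jx) true≢false

-- Classification of matrices with geodesic rows and columns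

geodesic-complement : {P : Matrix m n} → Geodesic P → Geodesic (complement P)
geodesic-complement geodesic i j x differ with geodesic i j x (differ ∘ cong not)
... | k , b , (change , agree) , toward =
  k , b , (change ∘ not-injective , λ c c≢b → cong not (agree c c≢b)) , toward ∘ not-injective

-- Both systems being well-graded, in a form closed under transposition and complementation.
record Balanced (P : Matrix m n) : Set where
  field
    geodesicRows    : Geodesic P
    geodesicColumns : Geodesic (P ᵀ)
    distinctRows    : DistinctRows P
    distinctColumns : DistinctRows (P ᵀ)

open Balanced

balanced-ᵀ : {P : Matrix m n} → Balanced P → Balanced (P ᵀ)
balanced-ᵀ B = record
  { geodesicRows    = geodesicColumns B
  ; geodesicColumns = geodesicRows B
  ; distinctRows    = distinctColumns B
  ; distinctColumns = distinctRows B
  }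

balanced-complement : {P : Matrix m n} → Balanced P → Balanced (complement P)
balanced-complement B = record
  { geodesicRows    = geodesic-complement (geodesicRows B)
  ; geodesicColumns = geodesic-complement (geodesicColumns B)
  ; distinctRows    = λ i j eq → distinctRows B i j (not-injective ∘ eq)
  ; distinctColumns = λ x y eq → distinctColumns B x y (not-injective ∘ eq)
  }

ConstantRow : Matrix m n → Bool → Fin m → Set
ConstantRow P a i = ∀ x → P i x ≡ a

constantRow? : (P : Matrix m n) → ∀ a → Dec (∃ (ConstantRow P a))
constantRow? P a = any? λ i → all? λ x → P i x ≟ᵇ a

-- Laminar columns leave each row at most one edge downwards; laminar rows leave each row other than
-- the empty one at most one edge upwards. Chains with an empty row and an empty column are
-- included.
Spider : Matrix m n → Set
Spider P = ∃ (ConstantRow P false) × ∃ (ConstantRow (P ᵀ) false) ×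
           LaminarColumns P × LaminarColumns (P ᵀ)

-- Labels of the row tree and of the column tree compose to a surjection
-- from the rows onto themselves, hence to an injection.
laminarColumns : {P : Matrix m n} → Balanced P → ∃ (ConstantRow P false) →
                 ∃ (ConstantRow (P ᵀ) false) → LaminarColumns P
laminarColumns {m} {P = P} B (r , empty) (z , emptyᶜ)
  -- The free labels are set to `z` and `r`, so the composite fixes `r`, the one row that is not the
  -- label of a column other than `z`.
  with descent (geodesicRows B) (distinctRows B) r z
     | descent (geodesicColumns B) (distinctColumns B) z r
... | D , D-root | E , E-root = LabelledTree.laminar empty D
        λ _ _ eq → onto⇒injective f onto (cong (Descent.label E) eq)
  where
  f : Fin m → Fin m
  f = Descent.label E ∘ Descent.label D

  onto : ∀ i → ∃ λ j → f j ≡ i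
  onto i with i ≟ᶠ r
  ... | yes refl = r , trans (cong (Descent.label E) D-root) E-root
  ... | no i≢r with ≗⊎≢ (P i) (P r)
  ...   | inj₁ same = contradiction (distinctRows B i r same) i≢r
  ...   | inj₂ (x , ix≢rx)
    with Descent.label-onto E x i (λ eq → ix≢rx (trans eq (trans (emptyᶜ i) (sym (empty x)))))
  ...     | y , y≢z , Ey≡i with ≗⊎≢ ((P ᵀ) y) ((P ᵀ) z)
  ...       | inj₁ same = contradiction (distinctColumns B y z same) y≢z
  ...       | inj₂ (k , ky≢kz)
    with Descent.label-onto D k y (λ eq → ky≢kz (trans eq (trans (empty y) (sym (emptyᶜ k)))))
  ...         | j , _ , Dj≡y = j , trans (cong (Descent.label E) Dj≡y) Ey≡i

spider : {P : Matrix m n} → Balanced P → ∃ (ConstantRow P false) →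
         ∃ (ConstantRow (P ᵀ) false) → Spider P
spider B row column =
  row , column , laminarColumns B row column , laminarColumns (balanced-ᵀ B) column row

-- Every column other than `z` is a row label: `o` is given to the root of the row tree as its free
-- label, and all others are nonconstant. Hence the composite labelling is onto, the labels of the
-- column tree are injective, and the rows are laminar. Any two rows meet in the full column `o`, so
-- they are nested.
chainOfRows : {P : Matrix m n} → Balanced P → ∃ (ConstantRow (P ᵀ) false) →
              ∃ (ConstantRow (P ᵀ) true) → ChainOfRows P
chainOfRows {m} {n} {P} B (z , empty) (o , full) i₁ i₂
  with descent (geodesicColumns B) (distinctColumns B) z i₁
... | E , _ with descent (geodesicRows B) (distinctRows B) (Descent.label E o) o
...   | D , D-root = LabelledTree.laminar empty E E-injective o i₁ i₂ (full i₁) (full i₂)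
  where
  open Descent

  i₀ : Fin m
  i₀ = label E o

  f : Fin m → Fin m
  f = label E ∘ label D

  column-label : ∀ y → y ≢ z → ∃ λ j → label D j ≡ y
  column-label y y≢z with y ≟ᶠ o
  ... | yes refl = i₀ , D-root
  ... | no y≢o with ≗⊎≢ ((P ᵀ) y) ((P ᵀ) z) | ≗⊎≢ ((P ᵀ) y) ((P ᵀ) o) | P i₀ y in i₀y
  ...   | inj₁ same | _ | _ = contradiction (distinctColumns B y z same) y≢z
  ...   | inj₂ _ | inj₁ same | _ = contradiction (distinctColumns B y o same) y≢o
  ...   | inj₂ (k , ky≢kz) | inj₂ _ | false
    with label-onto D k y (λ eq → ky≢kz (trans eq (trans i₀y (sym (empty k)))))
  ...     | j , _ , eq = j , eq
  column-label y y≢z | no y≢o | inj₂ _ | inj₂ (k , ky≢ko) | true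
    with label-onto D k y (λ eq → ky≢ko (trans eq (trans i₀y (sym (full k)))))
  ...     | j , _ , eq = j , eq

  onto : ∀ i → ∃ λ j → f j ≡ i
  onto i with label-onto E o i (λ eq → true≢false (trans (sym (full i)) (trans eq (empty i))))
  ... | y , y≢z , Ey≡i with column-label y y≢z
  ...   | j , Dj≡y = j , trans (cong (label E) Dj≡y) Ey≡i

  E-injective : InjectiveLabels E
  E-injective {y} {y′} y≢z y′≢z eq with column-label y y≢z | column-label y′ y′≢z
  ... | j , refl | j′ , refl = cong (label D) (onto⇒injective f onto eq)

differs-from : {f : Fin n → Bool} {x y : Fin n} → f x ≢ f y → ∀ z → ∃ λ w → f w ≢ f z
differs-from {f = f} {x} {y} fx≢fy z with f x ≟ᵇ f z
... | no fx≢fz  = x , fx≢fz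
... | yes fx≡fz = y , λ fy≡fz → fx≢fy (trans fx≡fz (sym fy≡fz))

-- Otherwise the column labels (a surjection from the columns only-⊤ than
-- z onto all rows) and the row labels (a surjection from the rows only-⊤
-- than r onto the columns only-⊤ than z) make too few rows.
constantRow : {P : Matrix m n} → Balanced P → Fin m → (z : Fin n) →
              (∀ y → y ≢ z → ∃₂ λ i j → P i y ≢ P j y) → ∃₂ λ a i → ConstantRow P a i
constantRow {m} {P = P} B r z nonconstant
  with any? (λ i → all? λ x → P i x ≟ᵇ P i z)
... | yes (i , const) = P i z , i , const
... | no none with descent (geodesicRows B) (distinctRows B) r z
                 | descent (geodesicColumns B) (distinctColumns B) z r
...   | D , D-root | E , E-root = contradiction (onto⇒injective f onto (trans fj≡r (sym fr≡r))) j≢r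
  where
  open Descent

  f : Fin m → Fin m
  f = label E ∘ label D

  fr≡r : f r ≡ r
  fr≡r = trans (cong (label E) D-root) E-root

  onto-from-nonroot : ∀ i → ∃ λ j → j ≢ r × f j ≡ i
  onto-from-nonroot i
    with ¬∀⟶∃¬ _ (λ x → P i x ≡ P i z) (λ x → P i x ≟ᵇ P i z) (λ const → none (i , const))
  ... | x , ix≢iz with label-onto E x i ix≢iz
  ...   | y , y≢z , Ey≡i with nonconstant y y≢z
  ...     | k , l , ky≢ly with differs-from {f = (P ᵀ) y} {k} {l} ky≢ly r
  ...       | w , wy≢ry with label-onto D w y wy≢ry
  ...         | j , j≢r , Dj≡y = j , j≢r , trans (cong (label E) Dj≡y) Ey≡i

  onto : ∀ i → ∃ λ j → f j ≡ i
  onto i = let j , _ , eq = onto-from-nonroot i in j , eq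

  j≢r : proj₁ (onto-from-nonroot r) ≢ r
  j≢r = proj₁ (proj₂ (onto-from-nonroot r))

  fj≡r : f (proj₁ (onto-from-nonroot r)) ≡ r
  fj≡r = proj₂ (proj₂ (onto-from-nonroot r))

nonconstantColumn : {P : Matrix m n} → ∀ y → ¬ ConstantRow (P ᵀ) false y →
                    ¬ ConstantRow (P ᵀ) true y → ∃₂ λ i j → P i y ≢ P j y
nonconstantColumn {m} {P = P} y notEmpty notFull
  with ¬∀⟶∃¬ m (λ i → P i y ≡ false) (λ i → P i y ≟ᵇ false) notEmpty
     | ¬∀⟶∃¬ m (λ i → P i y ≡ true)  (λ i → P i y ≟ᵇ true)  notFull
... | i , iy | j , jy = i , j , λ eq → iy (trans eq (≢true⇒≡false jy))

-- All columns other than `z` are nonconstant, so a constant row exists; where it crosses column `z`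
-- its value is `a`.
constantRow-of : {P : Matrix m n} → Balanced P → Fin m → ∀ a →
                 ∃ (ConstantRow (P ᵀ) a) → ¬ ∃ (ConstantRow (P ᵀ) (not a)) → ∃ (ConstantRow P a)
constantRow-of {P = P} B r a (z , constant) none
  with constantRow B r z (λ y y≢z → nonconstant a constant none y
         λ yConstant → y≢z (distinctColumns B y z λ i → trans (yConstant i) (sym (constant i))))
  where
  nonconstant : ∀ a → ConstantRow (P ᵀ) a z → ¬ ∃ (ConstantRow (P ᵀ) (not a)) → ∀ y →
                ¬ ConstantRow (P ᵀ) a y → ∃₂ λ i j → P i y ≢ P j y
  nonconstant false _ none y y-not = nonconstantColumn {P = P} y y-not λ c → none (y , c)
  nonconstant true  _ none y y-not = nonconstantColumn {P = P} y (λ c → none (y , c)) y-not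
... | a′ , i , constant′ = i , λ x → trans (constant′ x) (trans (sym (constant′ z)) (constant i))

Classification : Matrix m n → Set
Classification P = ChainOfRows P ⊎ Spider P ⊎ Spider (complement P)

classification : {P : Matrix m n} → Balanced P → Fin m → Classification P
classification {n = zero} B r = inj₁ λ _ _ → inj₁ λ ()
classification {n = suc n} {P} B r with constantRow? (P ᵀ) false | constantRow? (P ᵀ) true
... | yes empty | yes full = inj₁ (chainOfRows B empty full)
... | yes empty | no ¬full =
  inj₂ (inj₁ (spider B (constantRow-of B r false empty ¬full) empty))
... | no ¬empty | yes full with constantRow-of B r true full ¬empty
...   | i , row = inj₂ (inj₂ (spider (balanced-complement B)
                    (i , cong not ∘ row) (proj₁ full , cong not ∘ proj₂ full)))
-- Without constant columns some row is constant. If the constant rows were of one kind only, the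
-- transposed argument would produce a constant column; so both kinds occur, and the columns form a
-- chain.
classification {n = suc n} {P} B r | no ¬empty | no ¬full
  with constantRow? P false | constantRow? P true
... | yes empty | yes full = inj₁ (chainOfRows-ᵀ (chainOfRows (balanced-ᵀ B) empty full))
... | yes empty | no ¬fullʳ =
  contradiction (constantRow-of (balanced-ᵀ B) zero false empty ¬fullʳ) ¬empty
... | no ¬emptyʳ | yes full =
  contradiction (constantRow-of (balanced-ᵀ B) zero true full ¬emptyʳ) ¬full
... | no ¬emptyʳ | no ¬fullʳ
  with constantRow B r zero (λ y _ → nonconstantColumn {P = P} y (λ c → ¬empty (y , c)) (λ c → ¬full (y , c)))
...   | false , i , row = contradiction (i , row) ¬emptyʳ
...   | true  , i , row = contradiction (i , row) ¬fullʳ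

-- Extremality

Shatters : Matrix m n → (Fin n → Bool) → Set
Shatters {n = n} P Y = ∀ (Z : Fin n → Bool) → ∃ λ i → ∀ x → Y x ≡ true → P i x ≡ Z x

StronglyShatters : Matrix m n → (Fin n → Bool) → Set
StronglyShatters {n = n} P Y = ∃ λ (T : Fin n → Bool) → ∀ (Z : Fin n → Bool) →
  ∃ λ i → ∀ x → P i x ≡ (if Y x then Z x else T x)

ExtremalMatrix : Matrix m n → Set
ExtremalMatrix P = ∀ Y → Shatters P Y → StronglyShatters P Y

module Face {P : Matrix m n} (extremal : ExtremalMatrix P) (i : Fin m) where

  -- The face through row `i` in which exactly the coordinates outside `L` are free.
  Agrees : List (Fin n) → Fin m → Set
  Agrees L k = ∀ x → x ∈ˡ L → P k x ≡ P i x

  FaceShatters : List (Fin n) → (Fin n → Bool) → Set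
  FaceShatters L Y =
    ∀ (Z : Fin n → Bool) → ∃ λ k → Agrees L k × (∀ x → Y x ≡ true → P k x ≡ Z x)

  FaceStronglyShatters : List (Fin n) → (Fin n → Bool) → Set
  FaceStronglyShatters L Y = ∃ λ (T : Fin n → Bool) → ∀ (Z : Fin n → Bool) →
    ∃ λ k → Agrees L k × (∀ x → P k x ≡ (if Y x then Z x else T x))

  -- If the cube found for the larger face lies on the wrong side of the
  -- coordinate a, then Y ∪ {a} is shattered as well, and its cube meets
  -- both sides.
  face-extremal : ∀ L Y → (∀ x → x ∈ˡ L → Y x ≡ false) →
                  FaceShatters L Y → FaceStronglyShatters L Y
  face-extremal [] Y _ shatters with extremal Y (λ Z → let k , _ , eq = shatters Z in k , eq)
  ... | T , cube = T , λ Z → let k , eq = cube Z in k , (λ _ ()) , eq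
  face-extremal (a ∷ L) Y disjoint shatters
    with face-extremal L Y (λ x x∈L → disjoint x (there x∈L))
           (λ Z → let k , agrees , eq = shatters Z in k , (λ x x∈L → agrees x (there x∈L)) , eq)
  ... | T , cube with T a ≟ᵇ P i a
  ...   | yes Ta≡ia = T , λ Z → let k , agrees , eq = cube Z in
            k , agrees-∷ k Z agrees (eq a) , eq
    where
    agrees-∷ : ∀ k Z → Agrees L k → P k a ≡ (if Y a then Z a else T a) → Agrees (a ∷ L) k
    agrees-∷ k Z agrees eq x (there x∈L) = agrees x x∈L
    agrees-∷ k Z agrees eq x (here refl) with Y a | disjoint a (here refl)
    ... | .false | refl = trans eq Ta≡ia
  ...   | no Ta≢ia = both-sides (face-extremal L Y⁺ disjoint⁺ shatters⁺)
    where
    Y⁺ : Fin n → Bool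
    Y⁺ = updateAt Y a (const true)

    opposite : ∀ k Z → P k a ≡ (if Y a then Z a else T a) → P k a ≡ T a
    opposite k Z eq with Y a | disjoint a (here refl)
    ... | .false | refl = eq

    disjoint⁺ : ∀ x → x ∈ˡ L → Y⁺ x ≡ false
    disjoint⁺ x x∈L with x ≟ᶠ a
    ... | no x≢a = trans (updateAt-minimal x a Y x≢a) (disjoint x (there x∈L))
    -- If `a` occurred in `L`, every row of the cube would agree with `i` at `a`, against the choice
    -- of `T`. The pattern `Y` is arbitrary here.
    ... | yes refl = let k , agrees , eq = cube Y in
      contradiction (trans (sym (opposite k Y (eq x))) (agrees x x∈L)) Ta≢ia

    Y⁺⇒Y : ∀ {x} → x ≢ a → Y⁺ x ≡ true → Y x ≡ true
    Y⁺⇒Y x≢a x∈Y⁺ = trans (sym (updateAt-minimal _ a Y x≢a)) x∈Y⁺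

    shatters⁺ : FaceShatters L Y⁺
    shatters⁺ Z with Z a ≟ᵇ P i a
    -- Patterns with the value of `i` at `a` come from the smaller face, those with the opposite
    -- value from the cube on the wrong side.
    ... | yes Za≡ia = let k , agrees , eq = shatters Z in
      k , (λ x x∈L → agrees x (there x∈L)) , same k agrees eq
      where
      same : ∀ k → Agrees (a ∷ L) k → (∀ x → Y x ≡ true → P k x ≡ Z x) →
             ∀ x → Y⁺ x ≡ true → P k x ≡ Z x
      same k agrees eq x x∈Y⁺ with x ≟ᶠ a
      ... | yes refl = trans (agrees a (here refl)) (sym Za≡ia)
      ... | no x≢a = eq x (Y⁺⇒Y x≢a x∈Y⁺)
    ... | no Za≢ia = let k , agrees , eq = cube Z in k , agrees , other k eq
      where
      other : ∀ k → (∀ x → P k x ≡ (if Y x then Z x else T x)) →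
              ∀ x → Y⁺ x ≡ true → P k x ≡ Z x
      other k eq x x∈Y⁺ with x ≟ᶠ a
      ... | yes refl = trans (opposite k Z (eq a)) (≢∧≢⇒≡ Ta≢ia (≢-sym Za≢ia))
      ... | no x≢a with Y x | Y⁺⇒Y x≢a x∈Y⁺ | eq x
      ...   | .true | refl | kx = kx

    -- Fixing the coordinate `a` of the cube over `Y⁺` to its value in `i` leaves a cube over `Y`
    -- inside the smaller face.
    both-sides : FaceStronglyShatters L Y⁺ → FaceStronglyShatters (a ∷ L) Y
    both-sides (T⁺ , cube⁺) = updateAt T⁺ a (const (P i a)) , λ Z →
      let k , agrees , eq = cube⁺ (updateAt Z a (const (P i a))) in
      k , agrees-∷ Z k agrees (eq a) , values Z k eq
      where
      at-a : ∀ Z k → P k a ≡ (if Y⁺ a then updateAt Z a (const (P i a)) a else T⁺ a) → P k a ≡ P i a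
      at-a Z k eq with Y⁺ a | updateAt-updates a {const true} Y
      ... | .true | refl = trans eq (updateAt-updates a Z)

      agrees-∷ : ∀ Z k → Agrees L k →
                 P k a ≡ (if Y⁺ a then updateAt Z a (const (P i a)) a else T⁺ a) → Agrees (a ∷ L) k
      agrees-∷ Z k agrees eq x (here refl) = at-a Z k eq
      agrees-∷ Z k agrees eq x (there x∈L) = agrees x x∈L

      values : ∀ Z k → (∀ x → P k x ≡ (if Y⁺ x then updateAt Z a (const (P i a)) x else T⁺ x)) →
               ∀ x → P k x ≡ (if Y x then Z x else updateAt T⁺ a (const (P i a)) x)
      values Z k eq x with x ≟ᶠ a
      ... | yes refl rewrite disjoint a (here refl) =
        trans (at-a Z k (eq a)) (sym (updateAt-updates a T⁺))
      ... | no x≢a =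
        trans (eq x)
          (trans (cong (λ b → if b then updateAt Z a (const (P i a)) x else T⁺ x)
                       (updateAt-minimal x a Y x≢a))
                 (cong₂ (λ b c → if Y x then b else c)
                        (updateAt-minimal x a Z x≢a) (sym (updateAt-minimal x a T⁺ x≢a))))

-- In the face of rows agreeing with `i` wherever `j` does, the rows `i` and `j` shatter the
-- singleton of `y`, so this face contains an edge `k`, `l` labelled `y`, with `k` on the side of
-- `i`. If `k` is `i`, this edge is the step. Otherwise `k` lies strictly between `i` and `j`, and a
-- first step towards `k` is also one towards `j`.
extremal⇒geodesic : {P : Matrix m n} → ExtremalMatrix P → Geodesic P
extremal⇒geodesic {n = n} {P} extremal i j y = go _ j y ℕ.≤-refl
  where
  open Face extremal i

  go : ∀ d j y → hamming (P i) (P j) ≤ d → P i y ≢ P j y →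
       ∃₂ λ k b → FlipAt (P i) b (P k) × P i b ≢ P j b
  go zero j y bound iy≢jy = contradiction (ℕ.n≤0⇒n≡0 bound) (hamming-≢ (P i) (P j) y iy≢jy)
  go (suc d) j y bound iy≢jy = continue (face-extremal common Y disjoint shatters)
    where
    common : List (Fin n)
    common = filter (λ x → P i x ≟ᵇ P j x) (allFin n)

    Y : Fin n → Bool
    Y x = does (x ≟ᶠ y)

    Y⇒≡ : ∀ x → Y x ≡ true → x ≡ y
    Y⇒≡ x eq with x ≟ᶠ y | eq
    ... | yes x≡y | _ = x≡y

    agree : ∀ {x} → x ∈ˡ common → P i x ≡ P j x
    agree x∈ = proj₂ (∈-filter⁻ (λ x → P i x ≟ᵇ P j x) {xs = allFin n} x∈)

    disjoint : ∀ x → x ∈ˡ common → Y x ≡ false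
    disjoint x x∈ = dec-false (x ≟ᶠ y) λ { refl → iy≢jy (agree x∈) }

    shatters : FaceShatters common Y
    shatters Z with Z y ≟ᵇ P i y
    ... | yes Zy≡iy = i , (λ _ _ → refl) , λ x x∈Y → at-y x (Y⇒≡ x x∈Y)
      where
      at-y : ∀ x → x ≡ y → P i x ≡ Z x
      at-y x refl = sym Zy≡iy
    ... | no Zy≢iy = j , (λ x x∈ → sym (agree x∈)) , λ x x∈Y → at-y x (Y⇒≡ x x∈Y)
      where
      at-y : ∀ x → x ≡ y → P j x ≡ Z x
      at-y x refl = ≢∧≢⇒≡ (≢-sym iy≢jy) (≢-sym Zy≢iy)

    continue : FaceStronglyShatters common Y →
               ∃₂ λ k b → FlipAt (P i) b (P k) × P i b ≢ P j b
    continue (T , cube) with cube (const (P i y)) | cube (const (P j y))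
    ... | k , k-agrees , k-eq | l , _ , l-eq with ≗⊎≢ (P i) (P k)
    ...   | inj₁ same = l , y , (iy≢ly , λ x x≢y → trans (same x) (kx≡lx x x≢y)) , iy≢jy
      where
      ly≡jy : P l y ≡ P j y
      ly≡jy = trans (l-eq y) (cong (λ b → if b then P j y else T y) (dec-true (y ≟ᶠ y) refl))

      iy≢ly : P i y ≢ P l y
      iy≢ly eq = iy≢jy (trans eq ly≡jy)

      kx≡lx : ∀ x → x ≢ y → P k x ≡ P l x
      kx≡lx x x≢y = trans (off (k-eq x)) (sym (off (l-eq x)))
        where
        off : ∀ {a b} → a ≡ (if Y x then b else T x) → a ≡ T x
        off eq rewrite dec-false (x ≟ᶠ y) x≢y = eq
    ...   | inj₂ (w , differ) = result
      where
      between : ∀ x → P i x ≡ P j x → P i x ≡ P k x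
      between x eq = sym (k-agrees x (∈-filter⁺ (λ x → P i x ≟ᵇ P j x) (∈-allFin x) eq))

      iy≡ky : P i y ≡ P k y
      iy≡ky = sym (trans (k-eq y) (cong (λ b → if b then P i y else T y) (dec-true (y ≟ᶠ y) refl)))

      result : ∃₂ λ k b → FlipAt (P i) b (P k) × P i b ≢ P j b
      result with go d k w (s≤s⁻¹ (ℕ.≤-trans
                      (hamming-strictly-between between iy≢jy iy≡ky) bound)) differ
      ... | k′ , b , flip , toward = k′ , b , flip , λ eq → toward (between b eq)

NoShatteredPair : Matrix m n → Set
NoShatteredPair P = ∀ x y →
  ¬ (∀ a b → ∃ λ i → P i x ≡ a × P i y ≡ b)

-- A shattered set has at most one element. For the empty set any row is a cube; for a singleton an
-- edge with that label is one.
geodesic⇒extremal : {P : Matrix m n} → Geodesic P → NoShatteredPair P → ExtremalMatrix P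
geodesic⇒extremal {n = n} {P} geodesic noPair Y shatters with any? (λ x → Y x ≟ᵇ true)
... | no none = let i , _ = shatters Y in P i , λ Z → i , λ x → outside x
  where
  outside : ∀ x {a b} → b ≡ (if Y x then a else b)
  outside x with Y x in x∈Y
  ... | true  = contradiction (x , x∈Y) none
  ... | false = refl
... | yes (y , y∈Y) with shatters (const true) | shatters (const false)
...   | i , i-eq | j , j-eq
  with geodesic⇒edge geodesic i j y (λ eq → true≢false (trans (sym (i-eq y y∈Y)) (trans eq (j-eq y y∈Y))))
...     | k , l , ky≢ly , agree = P k , λ Z → pick Z (P k y ≟ᵇ Z y)
  where
  only-y : ∀ x → x ≢ y → Y x ≡ false
  only-y x x≢y = ≢true⇒≡false λ x∈Y → noPair x y λ a b →
    let i , eq = shatters (updateAt (const a) y (const b)) in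
    i , trans (eq x x∈Y) (updateAt-minimal x y (const a) x≢y) ,
        trans (eq y y∈Y) (updateAt-updates y (const a))

  pick : ∀ (Z : Fin n → Bool) → Dec (P k y ≡ Z y) → ∃ λ i → ∀ x → P i x ≡ (if Y x then Z x else P k x)
  pick Z (yes ky≡Zy) = k , values
    where
    values : ∀ x → P k x ≡ (if Y x then Z x else P k x)
    values x with x ≟ᶠ y
    ... | yes refl rewrite y∈Y = ky≡Zy
    ... | no x≢y rewrite only-y x x≢y = refl
  pick Z (no ky≢Zy) = l , values
    where
    values : ∀ x → P l x ≡ (if Y x then Z x else P k x)
    values x with x ≟ᶠ y
    ... | yes refl rewrite y∈Y = ≢∧≢⇒≡ (≢-sym ky≢ly) ky≢Zy
    ... | no x≢y rewrite only-y x x≢y = sym (agree x x≢y)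

chainOfRows⇒noShatteredPair : {P : Matrix m n} → ChainOfRows P → NoShatteredPair (P ᵀ)
chainOfRows⇒noShatteredPair chain i j all with chain i j | all true false | all false true
... | inj₁ i⊆j | x , ix , jx | _ = true≢false (trans (sym (i⊆j x ix)) jx)
... | inj₂ j⊆i | _ | y , iy , jy = true≢false (trans (sym (j⊆i y jy)) iy)

laminarColumns⇒noShatteredPair : {P : Matrix m n} → LaminarColumns P → NoShatteredPair P
laminarColumns⇒noShatteredPair laminar x y all with all true true
... | i , ix , iy with laminar i x y ix iy | all true false | all false true
...   | inj₁ x⊆y | j , jx , jy | _ = true≢false (trans (sym (x⊆y j jx)) jy)
...   | inj₂ y⊆x | _ | j , jx , jy = true≢false (trans (sym (y⊆x j jy)) jx)

noShatteredPair-complement : {P : Matrix m n} → NoShatteredPair (complement P) → NoShatteredPair P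
noShatteredPair-complement noPair x y all = noPair x y λ a b →
  let i , ix , iy = all (not a) (not b) in
  i , trans (cong not ix) (not-involutive a) , trans (cong not iy) (not-involutive b)

classification⇒noShatteredPair : {P : Matrix m n} → Classification P →
                                 NoShatteredPair P × NoShatteredPair (P ᵀ)
classification⇒noShatteredPair {P = P} (inj₁ chain) =
  chainOfRows⇒noShatteredPair {P = P ᵀ} (chainOfRows-ᵀ {P = P ᵀ} chain) ,
  chainOfRows⇒noShatteredPair {P = P} chain
classification⇒noShatteredPair {P = P} (inj₂ (inj₁ (_ , _ , columns , rows))) =
  laminarColumns⇒noShatteredPair {P = P} columns , laminarColumns⇒noShatteredPair {P = P ᵀ} rows
classification⇒noShatteredPair {P = P} (inj₂ (inj₂ (_ , _ , columns , rows))) =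
  noShatteredPair-complement {P = P} (laminarColumns⇒noShatteredPair {P = complement P} columns) ,
  noShatteredPair-complement {P = P ᵀ} (laminarColumns⇒noShatteredPair {P = complement P ᵀ} rows)

lookup-injective : {A : Set} {xs : List A} → Unique xs → ∀ i j →
                   List.lookup xs i ≡ List.lookup xs j → i ≡ j
lookup-injective {xs = _ ∷ _} _ zero zero _ = refl
lookup-injective {xs = _ ∷ _} (x≢ ∷ _) zero (suc j) eq = contradiction eq (All.lookup x≢ (∈-lookup j))
lookup-injective {xs = _ ∷ _} (x≢ ∷ _) (suc i) zero eq = contradiction (sym eq) (All.lookup x≢ (∈-lookup i))
lookup-injective {xs = _ ∷ _} (_ ∷ unique) (suc i) (suc j) eq = cong suc (lookup-injective unique i j eq)

-- Subsets as Boolean functions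

subset-ext : {A B : Subset n} → Vec.lookup A ≗ Vec.lookup B → A ≡ B
subset-ext {A = A} {B} eq =
  trans (sym (tabulate∘lookup A)) (trans (tabulate-cong eq) (tabulate∘lookup B))

∉⇒false : ∀ {x} {A : Subset n} → x ∉ A → Vec.lookup A x ≡ false
∉⇒false {x = x} {A} x∉A = ≢true⇒≡false λ eq → x∉A (lookup⇒[]= x A eq)

false⇒∉ : ∀ {x} {A : Subset n} → Vec.lookup A x ≡ false → x ∉ A
false⇒∉ eq x∈A = true≢false (trans (sym ([]=⇒lookup x∈A)) eq)

⊆⇒ : {A B : Subset n} → A ⊆ B → ∀ x → Vec.lookup A x ≡ true → Vec.lookup B x ≡ true
⊆⇒ {A = A} A⊆B x eq = []=⇒lookup (A⊆B (lookup⇒[]= x A eq))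

⇒⊆ : {A B : Subset n} → (∀ x → Vec.lookup A x ≡ true → Vec.lookup B x ≡ true) → A ⊆ B
⇒⊆ {B = B} sub {x} x∈A = lookup⇒[]= x B (sub x ([]=⇒lookup x∈A))

lookup-∩ : (A B : Subset n) → ∀ x → Vec.lookup (A ∩ B) x ≡ Vec.lookup A x ∧ Vec.lookup B x
lookup-∩ A B x = lookup-zipWith _∧_ x A B

lookup-∪ : (A B : Subset n) → ∀ x → Vec.lookup (A ∪ B) x ≡ Vec.lookup A x ∨ Vec.lookup B x
lookup-∪ A B x = lookup-zipWith _∨_ x A B

lookup-insert : (A : Subset n) → ∀ b → Vec.lookup (A ∪ ⁅ b ⁆) b ≡ true
lookup-insert A b = trans (lookup-∪ A ⁅ b ⁆ b)
  (trans (cong (Vec.lookup A b ∨_) ([]=⇒lookup (x∈⁅x⁆ b))) (∨-zeroʳ _))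

lookup-insert-≢ : (A : Subset n) → ∀ {b c} → c ≢ b → Vec.lookup (A ∪ ⁅ b ⁆) c ≡ Vec.lookup A c
lookup-insert-≢ A {b} {c} c≢b = trans (lookup-∪ A ⁅ b ⁆ c)
  (trans (cong (Vec.lookup A c ∨_) (∉⇒false (x≢y⇒x∉⁅y⁆ c≢b))) (∨-identityʳ _))

∣△∣≡hamming : (A B : Subset n) → ∣ A △ B ∣ ≡ hamming (Vec.lookup A) (Vec.lookup B)
∣△∣≡hamming [] [] = refl
∣△∣≡hamming (true  ∷ A) (true  ∷ B) = ∣△∣≡hamming A B
∣△∣≡hamming (true  ∷ A) (false ∷ B) = cong suc (∣△∣≡hamming A B)
∣△∣≡hamming (false ∷ A) (true  ∷ B) = cong suc (∣△∣≡hamming A B)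
∣△∣≡hamming (false ∷ A) (false ∷ B) = ∣△∣≡hamming A B

-- The incidence matrix

incidence : (F : Family n) → Matrix (size F) n
incidence F i = Vec.lookup (member F i)

incidence-distinct : (F : Family n) → DistinctRows (incidence F)
incidence-distinct F i j eq = lookup-injective (distinct F) i j (subset-ext eq)

module OneInclusion (F : Family n) where
  open Digraph (oneInclusion F)

  arc⇒flip : ∀ {i b j} → Arc i b j →
             FlipAt (incidence F i) b (incidence F j) × incidence F i b ≡ false
  arc⇒flip {i} {b} {j} (b∉i , j≡i∪b) rewrite j≡i∪b = ((λ eq →
      true≢false (trans (sym (lookup-insert (member F i) b)) (trans (sym eq) (∉⇒false b∉i)))) ,
    λ c c≢b → sym (lookup-insert-≢ (member F i) c≢b)) , ∉⇒false b∉i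

  flip⇒arc : ∀ {i b j} → FlipAt (incidence F i) b (incidence F j) →
             incidence F i b ≡ false → Arc i b j
  flip⇒arc {i} {b} {j} (change , agree) ib = false⇒∉ ib , subset-ext same
    where
    same : incidence F j ≗ Vec.lookup (member F i ∪ ⁅ b ⁆)
    same c with c ≟ᶠ b
    ... | yes refl = trans (≢false⇒≡true λ jb → change (trans ib (sym jb)))
                           (sym (lookup-insert (member F i) b))
    ... | no c≢b = trans (sym (agree c c≢b)) (sym (lookup-insert-≢ (member F i) c≢b))

  flip⇒adj : ∀ {i b j} → FlipAt (incidence F i) b (incidence F j) → Adj i j
  flip⇒adj {i} {b} flip with incidence F i b in ib
  ... | false = b , inj₁ (flip⇒arc flip′ ib)
    where flip′ = subst (λ a → a ≢ _) (sym ib) (proj₁ flip) , proj₂ flip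
  ... | true  = b , inj₂ (flip⇒arc (flipAt-sym flip′) (≢true⇒≡false (≢-sym (proj₁ flip))))
    where flip′ = subst (λ a → a ≢ _) (sym ib) (proj₁ flip) , proj₂ flip

  adj⇒flip : ∀ {i j} → Adj i j → ∃ λ b → FlipAt (incidence F i) b (incidence F j)
  adj⇒flip (b , inj₁ arc) = b , proj₁ (arc⇒flip arc)
  adj⇒flip (b , inj₂ arc) = b , flipAt-sym (proj₁ (arc⇒flip arc))

  hamming≤walk : ∀ {i j l} → Walk i j l → hamming (incidence F i) (incidence F j) ≤ l
  hamming≤walk {i} nil = ℕ.≤-reflexive (hamming-≗ {f = incidence F i} λ _ → refl)
  hamming≤walk {j = j} (cons adj walk) =
    ℕ.≤-trans (hamming-flip-≤ {h = incidence F j} (proj₂ (adj⇒flip adj))) (s≤s (hamming≤walk walk))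

  -- The step is the first edge of a shortest walk. If it flipped an entry in which `i` and `j`
  -- agree, the remaining Hamming distance would exceed the number `l` of remaining edges by two.
  wellGraded⇒geodesic : WellGraded F → Geodesic (incidence F)
  wellGraded⇒geodesic wellGraded i j x differ with wellGraded i j
  ... | walk , _ rewrite ∣△∣≡hamming (member F i) (member F j) = first-step walk refl
    where
    first-step : ∀ {l} → Walk i j l → hamming (incidence F i) (incidence F j) ≡ l →
                 ∃₂ λ k b → FlipAt (incidence F i) b (incidence F k) × incidence F i b ≢ incidence F j b
    first-step nil eq = contradiction refl differ
    first-step (cons {v = k} {k = l} adj walk) eq with adj⇒flip adj
    ... | b , flip = k , b , flip , λ ib≡jb →
      ℕ.<⇒≱ (ℕ.≤-trans (s≤s (ℕ.n≤1+n l)) (ℕ.≤-reflexive (sym (farther ib≡jb)))) (hamming≤walk walk)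
      where
      farther : incidence F i b ≡ incidence F j b →
                hamming (incidence F k) (incidence F j) ≡ suc (suc l)
      farther ib≡jb = trans (hamming-flip {h = incidence F j} (flipAt-sym flip)
        λ kb≡jb → proj₁ flip (trans ib≡jb (sym kb≡jb))) (cong suc eq)

  geodesic⇒wellGraded : Geodesic (incidence F) → WellGraded F
  geodesic⇒wellGraded geodesic i j rewrite ∣△∣≡hamming (member F i) (member F j) =
    walk-to i _ refl , λ _ → hamming≤walk
    where
    walk-to : ∀ i l → hamming (incidence F i) (incidence F j) ≡ l → Walk i j l
    walk-to i l eq with ≗⊎≢ (incidence F i) (incidence F j)
    ... | inj₁ same = subst (Walk i j) (trans (sym (hamming-≗ same)) eq)
                        (subst (λ k → Walk i k 0) (incidence-distinct F i j same) nil)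
    walk-to i zero eq | inj₂ (x , differ) =
      contradiction eq (hamming-≢ (incidence F i) (incidence F j) x differ)
    walk-to i (suc l) eq | inj₂ (x , differ) with geodesic i j x differ
    ... | k , b , flip , toward =
      cons (flip⇒adj flip)
           (walk-to k l (ℕ.suc-injective (trans (sym (hamming-flip {h = incidence F j} flip toward)) eq)))

open OneInclusion

-- Traces and shattering in terms of the incidence matrix

∈-fromList⁺ : {A : Subset n} {As : List (Subset n)} → A ∈ˡ As → A ∈ᶠ fromList As
∈-fromList⁺ = ∈-deduplicate⁺ _≟ˢ_

∈-fromList⁻ : {A : Subset n} (As : List (Subset n)) → A ∈ᶠ fromList As → A ∈ˡ As
∈-fromList⁻ As A∈ = ∈-deduplicate⁻ _≟ˢ_ As A∈

∈⇒member : {A : Subset n} (F : Family n) → A ∈ᶠ F → ∃ λ i → member F i ≡ A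
∈⇒member F A∈F = index A∈F , sym (lookup-index A∈F)

∈-trace⁺ : (F : Family n) (Y : Subset n) → ∀ i → (member F i ∩ Y) ∈ᶠ trace F Y
∈-trace⁺ F Y i = ∈-fromList⁺ (∈-map⁺ (_∩ Y) (∈-lookup i))

∈-trace⁻ : (F : Family n) (Y : Subset n) → ∀ {Z} → Z ∈ᶠ trace F Y → ∃ λ i → Z ≡ member F i ∩ Y
∈-trace⁻ F Y Z∈ with ∈-map⁻ (_∩ Y) (∈-fromList⁻ (List.map (_∩ Y) (members F)) Z∈)
... | A , A∈F , Z≡A∩Y with ∈⇒member F A∈F
...   | i , refl = i , Z≡A∩Y

shattered⇒shatters : (F : Family n) (Y : Subset n) → Shattered F Y → Shatters (incidence F) (Vec.lookup Y)
shattered⇒shatters F Y shattered Z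
  with ∈-trace⁻ F Y (Equivalence.from (shattered (Vec.tabulate Z ∩ Y)) (p∩q⊆q (Vec.tabulate Z) Y))
... | i , eq = i , λ x x∈Y →
  trans (sym (∩-at (member F i) x x∈Y))
    (trans (cong (λ A → Vec.lookup A x) (sym eq))
      (trans (∩-at (Vec.tabulate Z) x x∈Y) (lookup∘tabulate Z x)))
  where
  ∩-at : ∀ A x → Vec.lookup Y x ≡ true → Vec.lookup (A ∩ Y) x ≡ Vec.lookup A x
  ∩-at A x x∈Y = trans (lookup-∩ A Y x) (trans (cong (Vec.lookup A x ∧_) x∈Y) (∧-identityʳ _))

shatters⇒shattered : (F : Family n) (Y : Subset n) → Shatters (incidence F) (Vec.lookup Y) → Shattered F Y
shatters⇒shattered F Y shatters Z = mk⇔ to from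
  where
  to : Z ∈ᶠ trace F Y → Z ⊆ Y
  to Z∈ with ∈-trace⁻ F Y Z∈
  ... | i , refl = p∩q⊆q (member F i) Y

  from : Z ⊆ Y → Z ∈ᶠ trace F Y
  from Z⊆Y with shatters (Vec.lookup Z)
  ... | i , eq = subst (_∈ᶠ trace F Y) (subset-ext same) (∈-trace⁺ F Y i)
    where
    same : ∀ x → Vec.lookup (member F i ∩ Y) x ≡ Vec.lookup Z x
    same x with Vec.lookup Y x in Yx
    ... | true  = trans (lookup-∩ (member F i) Y x)
                    (trans (cong (incidence F i x ∧_) Yx) (trans (∧-identityʳ _) (eq x Yx)))
    ... | false = trans (lookup-∩ (member F i) Y x)
                    (trans (cong (incidence F i x ∧_) Yx) (trans (∧-zeroʳ _)
                      (sym (≢true⇒≡false λ Zx → true≢false (trans (sym (⊆⇒ Z⊆Y x Zx)) Yx)))))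

stronglyShattered⇒stronglyShatters : (F : Family n) (Y : Subset n) →
            StronglyShattered F Y → StronglyShatters (incidence F) (Vec.lookup Y)
stronglyShattered⇒stronglyShatters F Y (T , T⊆∁Y , cube) = Vec.lookup T , λ Z →
  let i , eq = ∈⇒member F (cube (Vec.tabulate Z ∩ Y) (p∩q⊆q (Vec.tabulate Z) Y)) in
  i , λ x → trans (cong (λ A → Vec.lookup A x) eq) (values Z x)
  where
  values : ∀ Z x → Vec.lookup ((Vec.tabulate Z ∩ Y) ∪ T) x ≡
                   (if Vec.lookup Y x then Z x else Vec.lookup T x)
  values Z x rewrite lookup-∪ (Vec.tabulate Z ∩ Y) T x | lookup-∩ (Vec.tabulate Z) Y x
                   | lookup∘tabulate Z x with Vec.lookup Y x in Yx
  ... | false rewrite ∧-zeroʳ (Z x) = refl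
  ... | true rewrite ∧-identityʳ (Z x)
                   | ∉⇒false {x = x} {T} (λ x∈T → x∈∁p⇒x∉p (T⊆∁Y x∈T) (lookup⇒[]= x Y Yx)) =
    ∨-identityʳ (Z x)

stronglyShatters⇒stronglyShattered : (F : Family n) (Y : Subset n) →
            StronglyShatters (incidence F) (Vec.lookup Y) → StronglyShattered F Y
stronglyShatters⇒stronglyShattered F Y (T , cube) = T∖Y , T∖Y⊆∁Y , λ Z Z⊆Y →
  let i , eq = cube (Vec.lookup Z) in
  subst (_∈ᶠ F) (subset-ext λ x → trans (eq x) (sym (values Z Z⊆Y x))) (∈-lookup i)
  where
  T∖Y = Vec.tabulate T ∩ ∁ Y

  T∖Y⊆∁Y : T∖Y ⊆ ∁ Y
  T∖Y⊆∁Y = p∩q⊆q (Vec.tabulate T) (∁ Y)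

  values : ∀ Z → Z ⊆ Y → ∀ x → Vec.lookup (Z ∪ T∖Y) x ≡
                               (if Vec.lookup Y x then Vec.lookup Z x else T x)
  values Z Z⊆Y x rewrite lookup-∪ Z T∖Y x | lookup-∩ (Vec.tabulate T) (∁ Y) x
                       | lookup∘tabulate T x with Vec.lookup Y x in Yx
  ... | true rewrite ∉⇒false {x = x} {∁ Y} (λ x∈∁Y → x∈∁p⇒x∉p x∈∁Y (lookup⇒[]= x Y Yx))
                   | ∧-zeroʳ (T x) = ∨-identityʳ (Vec.lookup Z x)
  ... | false rewrite []=⇒lookup (x∉p⇒x∈∁p (false⇒∉ {x = x} {Y} Yx)) | ∧-identityʳ (T x)
                    | ∉⇒false {x = x} {Z} (λ x∈Z → false⇒∉ {x = x} {Y} Yx (Z⊆Y x∈Z)) = refl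

stronglyShatters⇒shatters : {P : Matrix m n} {Y : Fin n → Bool} → StronglyShatters P Y → Shatters P Y
stronglyShatters⇒shatters (T , cube) Z = let i , eq = cube Z in i , λ x x∈Y →
  trans (eq x) (cong (λ b → if b then Z x else T x) x∈Y)

extremalMatrix⇒extremal : (F : Family n) → ExtremalMatrix (incidence F) → Extremal F
extremalMatrix⇒extremal F extremal Y = mk⇔
  (λ shattered → stronglyShatters⇒stronglyShattered F Y (extremal _ (shattered⇒shatters F Y shattered)))
  (λ strongly → shatters⇒shattered F Y
    (stronglyShatters⇒shatters {P = incidence F} (stronglyShattered⇒stronglyShatters F Y strongly)))

extremal⇒extremalMatrix : (F : Family n) → Extremal F → ExtremalMatrix (incidence F)
extremal⇒extremalMatrix F extremal Y shatters =
  let T , cube = stronglyShattered⇒stronglyShatters F S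
        (Equivalence.to (extremal S) (shatters⇒shattered F S λ Z →
          let i , eq = shatters Z in i , λ x x∈S → eq x (trans (sym (lookup∘tabulate Y x)) x∈S))) in
  T , λ Z → let i , eq = cube Z in
    i , λ x → trans (eq x) (cong (λ b → if b then Z x else T x) (lookup∘tabulate Y x))
  where S = Vec.tabulate Y

extremal⇒wellGraded : (F : Family n) → Extremal F → WellGraded F
extremal⇒wellGraded F =
  geodesic⇒wellGraded F ∘ extremal⇒geodesic ∘ extremal⇒extremalMatrix F

-- The dual system

module _ (F : Family n) where

  -- The incidence matrix of `F` with repeated columns merged. The rows keep their indices.
  dualMatrix : Matrix (size F) (size (dual F))
  dualMatrix = incidence (dual F) ᵀ

  dualIndex : ∀ x → ∃ λ y → ∀ i → dualMatrix i y ≡ incidence F i x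
  dualIndex x with ∈⇒member (dual F) (∈-fromList⁺ (∈-tabulate⁺ {f = dualSet F} x))
  ... | y , eq = y , λ i → trans (cong (λ A → Vec.lookup A i) eq) (lookup∘tabulate _ i)

  dualElement : ∀ y → ∃ λ x → ∀ i → dualMatrix i y ≡ incidence F i x
  dualElement y
    with ∈-tabulate⁻ {f = dualSet F} (∈-fromList⁻ (List.tabulate (dualSet F)) (∈-lookup {xs = members (dual F)} y))
  ... | x , eq = x , λ i → trans (cong (λ A → Vec.lookup A i) eq) (lookup∘tabulate _ i)

  -- A single flip stays single after merging: a merged column other than that of `b` comes from an
  -- element other than `b`.
  dual-balanced : Geodesic (incidence F) → Geodesic (incidence (dual F)) → Balanced dualMatrix
  dual-balanced geodesic geodesicᵈ = record
    { geodesicRows    = rows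
    ; geodesicColumns = geodesicᵈ
    ; distinctRows    = λ i j eq → incidence-distinct F i j λ x →
        let y , at = dualIndex x in trans (sym (at i)) (trans (eq y) (at j))
    ; distinctColumns = incidence-distinct (dual F)
    }
    where
    rows : Geodesic dualMatrix
    rows i j y differ with dualElement y
    ... | x , atx with geodesic i j x (λ eq → differ (trans (atx i) (trans eq (sym (atx j)))))
    ...   | k , b , (change , agree) , toward with dualIndex b
    ...     | c , atc = k , c , ((λ eq → change (trans (sym (atc i)) (trans eq (atc k)))) , same) ,
                        λ eq → toward (trans (sym (atc i)) (trans eq (atc j)))
      where
      same : ∀ y → y ≢ c → dualMatrix i y ≡ dualMatrix k y
      same y y≢c with dualElement y
      ... | x′ , atx′ = trans (atx′ i) (trans (agree x′ λ { refl →
        y≢c (incidence-distinct (dual F) y c λ i → trans (atx′ i) (sym (atc i))) }) (sym (atx′ k)))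

  geodesic-dual : Geodesic (incidence F ᵀ) → Geodesic (incidence (dual F))
  geodesic-dual geodesic y y′ i differ with dualElement y | dualElement y′
  ... | x , at | x′ , at′ with geodesic x x′ i (λ eq → differ (trans (at i) (trans eq (sym (at′ i)))))
  ...   | k , j , (change , agree) , toward with dualIndex k
  ...     | c , atc = c , j ,
    ((λ eq → change (trans (sym (at j)) (trans eq (atc j)))) ,
      λ l l≢j → trans (at l) (trans (agree l l≢j) (sym (atc l)))) ,
    λ eq → toward (trans (sym (at j)) (trans eq (at′ j)))

-- Equality of matrices up to order and repetition of columns. Chain and spider shapes are
-- insensitive to both, which brings the classification of `dualMatrix F` back to `incidence F`.
SameColumns : {k : ℕ} → Matrix m n → Matrix m k → Set
SameColumns P Q = (∀ x → ∃ λ y → ∀ i → P i x ≡ Q i y) × (∀ y → ∃ λ x → ∀ i → P i x ≡ Q i y)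

sameColumns-dual : (F : Family n) → SameColumns (incidence F) (dualMatrix F)
sameColumns-dual F =
  (λ x → let y , at = dualIndex F x in y , sym ∘ at) ,
  (λ y → let x , at = dualElement F y in x , sym ∘ at)

sameColumns-complement : ∀ {k} {P : Matrix m n} {Q : Matrix m k} →
                         SameColumns P Q → SameColumns (complement P) (complement Q)
sameColumns-complement (to , from) =
  (λ x → let y , at = to x in y , λ i → cong not (at i)) ,
  (λ y → let x , at = from y in x , λ i → cong not (at i))

module _ {k : ℕ} {P : Matrix m n} {Q : Matrix m k} (same : SameColumns P Q) where

  chainOfRows-same : ChainOfRows Q → ChainOfRows P
  chainOfRows-same chain i j with chain i j
  ... | inj₁ i⊆j = inj₁ λ x ix → let y , at = proj₁ same x in
    trans (at j) (i⊆j y (trans (sym (at i)) ix))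
  ... | inj₂ j⊆i = inj₂ λ x jx → let y , at = proj₁ same x in
    trans (at i) (j⊆i y (trans (sym (at j)) jx))

  laminarColumns-same : LaminarColumns Q → LaminarColumns P
  laminarColumns-same laminar i x x′ ix ix′ with proj₁ same x | proj₁ same x′
  ... | y , at | y′ , at′ with laminar i y y′ (trans (sym (at i)) ix) (trans (sym (at′ i)) ix′)
  ...   | inj₁ y⊆y′ = inj₁ λ l lx → trans (at′ l) (y⊆y′ l (trans (sym (at l)) lx))
  ...   | inj₂ y′⊆y = inj₂ λ l lx → trans (at l) (y′⊆y l (trans (sym (at′ l)) lx))

  laminarRows-same : LaminarColumns (Q ᵀ) → LaminarColumns (P ᵀ)
  laminarRows-same laminar x i j ix jx with proj₁ same x
  ... | y , at with laminar y i j (trans (sym (at i)) ix) (trans (sym (at j)) jx)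
  ...   | inj₁ i⊆j = inj₁ λ x′ ix′ → let y′ , at′ = proj₁ same x′ in
    trans (at′ j) (i⊆j y′ (trans (sym (at′ i)) ix′))
  ...   | inj₂ j⊆i = inj₂ λ x′ jx′ → let y′ , at′ = proj₁ same x′ in
    trans (at′ i) (j⊆i y′ (trans (sym (at′ j)) jx′))

  spider-same : Spider Q → Spider P
  spider-same ((r , empty) , (z , emptyᶜ) , columns , rows) =
    (r , λ x → let y , at = proj₁ same x in trans (at r) (empty y)) ,
    (let x , at = proj₂ same z in x , λ i → trans (at i) (emptyᶜ i)) ,
    laminarColumns-same columns , laminarRows-same rows

classification-same : ∀ {k} {P : Matrix m n} {Q : Matrix m k} →
                      SameColumns P Q → Classification Q → Classification P
classification-same same (inj₁ chain)         = inj₁ (chainOfRows-same same chain)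
classification-same same (inj₂ (inj₁ spider)) = inj₂ (inj₁ (spider-same same spider))
classification-same same (inj₂ (inj₂ spider)) =
  inj₂ (inj₂ (spider-same (sameColumns-complement same) spider))

-- From well-graded to extremal

module _ (F : Family n) where

  dual-classification : Fin (size F) → WellGraded F → WellGraded (dual F) →
                        Classification (dualMatrix F)
  dual-classification i wellGraded wellGradedᵈ = classification
    (dual-balanced F (wellGraded⇒geodesic F wellGraded)
                     (wellGraded⇒geodesic (dual F) wellGradedᵈ)) i

  wellGraded⇒extremal : Fin (size F) → SelfAndDual WellGraded F → SelfAndDual Extremal F
  wellGraded⇒extremal i (wellGraded , wellGradedᵈ) =
    extremal F wellGraded
      (proj₁ (classification⇒noShatteredPair (classification-same (sameColumns-dual F) class))) ,
    extremal (dual F) wellGradedᵈ (proj₂ (classification⇒noShatteredPair {P = dualMatrix F} class))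
    where
    class = dual-classification i wellGraded wellGradedᵈ

    extremal : ∀ {k} (G : Family k) → WellGraded G → NoShatteredPair (incidence G) → Extremal G
    extremal G wellGraded noPair =
      extremalMatrix⇒extremal G (geodesic⇒extremal (wellGraded⇒geodesic G wellGraded) noPair)

unique-⊆⇒length≤ : {A : Set} {xs ys : List A} → Unique xs → (∀ {x} → x ∈ˡ xs → x ∈ˡ ys) →
                   length xs ≤ length ys
unique-⊆⇒length≤ {xs = xs} {ys} unique xs⊆ys = injective⇒≤ {f = λ i → index (xs⊆ys (∈-lookup {xs = xs} i))}
  λ {i} {j} eq → lookup-injective unique i j
    (trans (lookup-index (xs⊆ys (∈-lookup i)))
      (trans (cong (List.lookup ys) eq) (sym (lookup-index (xs⊆ys (∈-lookup j))))))

unique-resp-↭ : {A : Set} {xs ys : List A} → xs ↭ ys → Unique xs → Unique ys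
unique-resp-↭ {A} xs↭ys = AllPairs-resp-↭ (setoid A) ≢-sym (resp₂ _≢_) (↭⇒↭ₛ xs↭ys)

-- Full chains

lookup-─ : (A B : Subset n) → ∀ x → Vec.lookup (A ─ B) x ≡ Vec.lookup A x ∧ not (Vec.lookup B x)
lookup-─ (true  ∷ _) (true  ∷ _) zero = refl
lookup-─ (true  ∷ _) (false ∷ _) zero = refl
lookup-─ (false ∷ _) (true  ∷ _) zero = refl
lookup-─ (false ∷ _) (false ∷ _) zero = refl
lookup-─ (_ ∷ A) (_ ∷ B) (suc x) = lookup-─ A B x

flip⇒∣─∣≡1 : {A B : Subset n} {b : Fin n} → FlipAt (Vec.lookup A) b (Vec.lookup B) →
             Vec.lookup A b ≡ false → ∣ B ─ A ∣ ≡ 1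
flip⇒∣─∣≡1 {A = A} {B} {b} (change , agree) Ab = trans (cong ∣_∣ (subset-ext {A = B ─ A} {⁅ b ⁆} same)) (∣⁅x⁆∣≡1 b)
  where
  same : ∀ x → Vec.lookup (B ─ A) x ≡ Vec.lookup ⁅ b ⁆ x
  same x rewrite lookup-─ B A x with x ≟ᶠ b
  ... | yes refl rewrite Ab | []=⇒lookup (x∈⁅x⁆ x) | ≢false⇒≡true (≢-sym change) = refl
  ... | no x≢b rewrite agree x x≢b | ∉⇒false (x≢y⇒x∉⁅y⁆ x≢b) with Vec.lookup B x
  ...   | true  = refl
  ...   | false = refl

⊆∧∣≥∣⇒≡ : {A B : Subset n} → A ⊆ B → ∣ B ∣ ≤ ∣ A ∣ → A ≡ B
⊆∧∣≥∣⇒≡ {A = A} {B} A⊆B ∣B∣≤∣A∣ = ⊆-antisym A⊆B B⊆A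
  where
  B⊆A : B ⊆ A
  B⊆A {x} x∈B with x ∈? A
  ... | yes x∈A = x∈A
  ... | no x∉A = contradiction ∣B∣≤∣A∣ (ℕ.<⇒≱ (p⊂q⇒∣p∣<∣q∣ (A⊆B , x , x∈B , x∉A)))

module _ (F : Family n) (geodesic : Geodesic (incidence F)) (chain : ChainOfRows (incidence F)) where

  private
    Step : Subset n → Subset n → Set
    Step A B = A ⊆ B × ∣ B ─ A ∣ ≡ 1

    smaller⇒⊆ : ∀ {A B} → A ∈ᶠ F → B ∈ᶠ F → ∣ A ∣ ≤ ∣ B ∣ → A ⊆ B
    smaller⇒⊆ A∈F B∈F ∣A∣≤∣B∣ with ∈⇒member F A∈F | ∈⇒member F B∈F
    ... | i , refl | j , refl with chain i j
    ...   | inj₁ i⊆j = ⇒⊆ (i⊆j)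
    ...   | inj₂ j⊆i = subst (member F i ⊆_)
      (sym (⊆∧∣≥∣⇒≡ {A = member F j} {member F i} (⇒⊆ j⊆i) ∣A∣≤∣B∣)) (λ x∈ → x∈)

    next : ∀ {A B} → A ∈ᶠ F → B ∈ᶠ F → A ⊆ B → A ≢ B →
           ∃ λ K → K ∈ᶠ F × ∣ A ∣ < ∣ K ∣ × K ⊆ B × Step A K
    next A∈F B∈F A⊆B A≢B with ∈⇒member F A∈F | ∈⇒member F B∈F
    ... | i , refl | j , refl with ≗⊎≢ (incidence F i) (incidence F j)
    ...   | inj₁ same = contradiction (subset-ext same) A≢B
    ...   | inj₂ (x , differ) with geodesic i j x differ
    ...     | k , b , (change , agree) , toward =
      member F k , ∈-lookup k ,
      p⊂q⇒∣p∣<∣q∣ (i⊆k , b , lookup⇒[]= b (member F k) kb , false⇒∉ ib) ,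
      ⇒⊆ k⊆j , i⊆k , flip⇒∣─∣≡1 {A = member F i} {B = member F k} (change , agree) ib
      where
      ib : incidence F i b ≡ false
      ib = ≢true⇒≡false λ eq → toward (trans eq (sym (⊆⇒ A⊆B b eq)))

      kb : incidence F k b ≡ true
      kb = ≢false⇒≡true λ eq → change (trans ib (sym eq))

      k⊆j : ∀ x → incidence F k x ≡ true → incidence F j x ≡ true
      k⊆j x kx with x ≟ᶠ b
      ... | yes refl = ≢false⇒≡true λ eq → toward (trans ib (sym eq))
      ... | no x≢b = ⊆⇒ A⊆B x (trans (agree x x≢b) kx)

      i⊆k : member F i ⊆ member F k
      i⊆k = ⇒⊆ λ x ix → trans (sym (agree x λ { refl → true≢false (trans (sym ix) ib) })) ix

    order = on-decTotalOrder ℕ.≤-decTotalOrder (∣_∣ {n})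

    -- The invariant is that every member larger than the head is still to come. The member `K` one
    -- step above `A` is therefore in the tail and at least as large as `B`; being a subset of `B`,
    -- it equals `B`.
    steps : ∀ As → AllPairs (λ A B → ∣ A ∣ ≤ ∣ B ∣) As → Unique As → (∀ {K} → K ∈ˡ As → K ∈ᶠ F) →
            (∀ {A Bs} → As ≡ A ∷ Bs → ∀ {K} → K ∈ᶠ F → ∣ A ∣ < ∣ K ∣ → K ∈ˡ Bs) →
            Linked Step As
    steps [] _ _ _ _ = []
    steps (A ∷ []) _ _ _ _ = [-]
    steps (A ∷ B ∷ Cs) ((A≤B ∷ _) ∷ sorted@(B≤Cs ∷ _)) ((A≢B ∷ _) ∷ unique) As⊆F above
      with next (As⊆F (here refl)) (As⊆F (there (here refl)))
             (smaller⇒⊆ (As⊆F (here refl)) (As⊆F (there (here refl))) A≤B) A≢B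
    ... | K , K∈F , A<K , K⊆B , step =
      subst (Step A) K≡B step ∷ steps (B ∷ Cs) sorted unique (As⊆F ∘ there) above′
      where
      B≤K : ∀ {K} → K ∈ˡ B ∷ Cs → ∣ B ∣ ≤ ∣ K ∣
      B≤K (here refl) = ℕ.≤-refl
      B≤K (there K∈Cs) = All.lookup B≤Cs K∈Cs

      K≡B : K ≡ B
      K≡B = ⊆∧∣≥∣⇒≡ K⊆B (B≤K (above refl K∈F A<K))

      above′ : ∀ {A′ Bs} → B ∷ Cs ≡ A′ ∷ Bs → ∀ {K} → K ∈ᶠ F → ∣ A′ ∣ < ∣ K ∣ → K ∈ˡ Bs
      above′ refl K∈F B<K with above refl K∈F (ℕ.≤-<-trans A≤B B<K)
      ... | here refl = contradiction B<K (ℕ.<-irrefl refl)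
      ... | there K∈Cs = K∈Cs

  chainOfRows⇒fullChain : FullChain F
  chainOfRows⇒fullChain = sorted , sorted↭F ,
    steps sorted (Linked⇒AllPairs ℕ.≤-trans (Sort.sort-↗ order (members F)))
          (unique-resp-↭ (↭-sym sorted↭F) (distinct F)) (∈-resp-↭ sorted↭F) above
    where
    sorted = Sort.sort order (members F)

    sorted↭F : sorted ↭ members F
    sorted↭F = Sort.sort-↭ order (members F)

    above : ∀ {A Bs} → sorted ≡ A ∷ Bs → ∀ {K} → K ∈ᶠ F → ∣ A ∣ < ∣ K ∣ → K ∈ˡ Bs
    above eq K∈F A<K with subst (_ ∈ˡ_) eq (∈-resp-↭ (↭-sym sorted↭F) K∈F)
    ... | here refl = contradiction A<K (ℕ.<-irrefl refl)
    ... | there K∈Bs = K∈Bs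

greatest : {R : Fin m → Fin m → Set} → (∀ {i j k} → R i j → R j k → R i k) → (∀ i j → R i j ⊎ R j i) →
           {Q : Fin m → Set} → (∀ i → Dec (Q i)) → ∃ Q → ∃ λ k → Q k × (∀ j → Q j → R j k)
greatest {suc m} {R} R-trans total {Q} Q? (i , Qi) with any? (Q? ∘ suc)
... | no none = zero , only-zero i Qi ,
  λ { zero _ → reduce (total zero zero) ; (suc j) Qj → contradiction (j , Qj) none }
  where
  only-zero : ∀ i → Q i → Q zero
  only-zero zero    Qi = Qi
  only-zero (suc i) Qi = contradiction (i , Qi) none
... | yes some
  with greatest {R = λ i j → R (suc i) (suc j)} R-trans (λ i j → total (suc i) (suc j)) (Q? ∘ suc) some
...   | k , Qk , above with Q? zero | total zero (suc k)
...     | no ¬Q0 | _ = suc k , Qk , λ { zero Q0 → contradiction Q0 ¬Q0 ; (suc j) Qj → above j Qj }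
...     | yes _  | inj₁ 0≤k = suc k , Qk , λ { zero _ → 0≤k ; (suc j) Qj → above j Qj }
...     | yes Q0 | inj₂ k≤0 = zero , Q0 , λ
  { zero _ → reduce (total zero zero) ; (suc j) Qj → R-trans (above j Qj) k≤0 }

-- If x lies below y in the chain of columns, the column just above x
-- arises by adding the largest row k without x.  It belongs to the element
-- whose removal leads from k to the next smaller row, or it is y if k is
-- the least row.
chainOfRows⇒ascent : {P : Matrix m n} → DistinctRows P → ChainOfRows P → Geodesic P →
                     ∀ i x y → P i x ≡ false → P i y ≡ true →
                     ∃₂ λ z k → FlipAt ((P ᵀ) x) k ((P ᵀ) z) × P k x ≢ P k y
chainOfRows⇒ascent {m} {n} {P} distinctRows chain geodesic i x y ix iy
  with greatest (λ i⊆j j⊆k w iw → j⊆k w (i⊆j w iw)) chain (λ i → P i x ≟ᵇ false) (i , ix)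
... | k , kx , without⊆k = result
  where
  k⊆with : ∀ i → P i x ≡ true → ∀ w → P k w ≡ true → P i w ≡ true
  k⊆with i ix w kw with chain i k
  ... | inj₁ i⊆k = contradiction (trans (sym (i⊆k x ix)) kx) true≢false
  ... | inj₂ k⊆i = k⊆i w kw

  ky : P k y ≡ true
  ky = without⊆k i ix y iy

  ascend-to : ∀ z → P k z ≡ true → (∀ c → c ≢ k → P c x ≡ false → P c z ≡ false) →
              ∃₂ λ z k → FlipAt ((P ᵀ) x) k ((P ᵀ) z) × P k x ≢ P k y
  ascend-to z kz only-k = z , k ,
    ((λ eq → true≢false (trans (sym kz) (trans (sym eq) kx))) , agree) ,
    λ eq → true≢false (trans (sym ky) (trans (sym eq) kx))
    where
    agree : ∀ c → c ≢ k → P c x ≡ P c z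
    agree c c≢k with P c x in cx
    ... | true  = sym (k⊆with c cx z kz)
    ... | false = sym (only-k c c≢k cx)

  result : ∃₂ λ z k → FlipAt ((P ᵀ) x) k ((P ᵀ) z) × P k x ≢ P k y
  result with any? (λ c → (P c x ≟ᵇ false) ×-dec any? (λ w → (P k w ≟ᵇ true) ×-dec (P c w ≟ᵇ false)))
  ... | no least = ascend-to y ky λ c c≢k cx → contradiction (distinctRows c k (same c cx)) c≢k
    where
    same : ∀ c → P c x ≡ false → P c ≗ P k
    same c cx w with P c w in cw
    ... | true  = sym (without⊆k c cx w cw)
    ... | false = sym (≢true⇒≡false λ kw → least (c , cx , w , kw , cw))
  ... | yes (c , cx , w , kw , cw) with geodesic k c w (λ eq → true≢false (trans (sym kw) (trans eq cw)))
  ...   | k′ , z , (change , agree) , toward = ascend-to z kz only-k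
    where
    kz : P k z ≡ true
    kz = ≢false⇒≡true λ kz → toward (trans kz
      (sym (≢true⇒≡false λ cz → true≢false (trans (sym (without⊆k c cx z cz)) kz))))

    k′z : P k′ z ≡ false
    k′z = ≢true⇒≡false λ k′z → change (trans kz (sym k′z))

    only-k : ∀ c → c ≢ k → P c x ≡ false → P c z ≡ false
    only-k c c≢k cx = ≢true⇒≡false λ cz → c≢k (distinctRows c k (same cz))
      where
      -- `c` contains `z`, which `k′` lacks, so the chain puts `k′` inside `c`; and `k` is `k′` with
      -- `z` added.
      k⊆c : P c z ≡ true → ∀ w → P k w ≡ true → P c w ≡ true
      k⊆c cz w kw with w ≟ᶠ z | chain c k′
      ... | yes refl | _ = cz
      ... | no _ | inj₁ c⊆k′ = contradiction (trans (sym (c⊆k′ z cz)) k′z) true≢false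
      ... | no w≢z | inj₂ k′⊆c = k′⊆c w (trans (sym (agree w w≢z)) kw)

      same : P c z ≡ true → P c ≗ P k
      same cz w with P c w in cw
      ... | true  = sym (without⊆k c cx w cw)
      ... | false = sym (≢true⇒≡false λ kw → true≢false (trans (sym (k⊆c cz w kw)) cw))

chainOfRows-complement : {P : Matrix m n} → ChainOfRows P → ChainOfRows (complement P)
chainOfRows-complement {P = P} chain i j with chain i j
... | inj₁ i⊆j = inj₂ λ x ¬jx → not≡true (P i x) λ ix →
  true≢false (trans (sym ¬jx) (cong not (i⊆j x ix)))
  where
  not≡true : ∀ a → a ≢ true → not a ≡ true
  not≡true a a≢true = cong not (≢true⇒≡false a≢true)
... | inj₂ j⊆i = inj₁ λ x ¬ix → cong not (≢true⇒≡false λ jx →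
  true≢false (trans (sym ¬ix) (cong not (j⊆i x jx))))

chainOfRows-complement⁻ : {P : Matrix m n} → ChainOfRows (complement P) → ChainOfRows P
chainOfRows-complement⁻ {P = P} chain i j with chain i j
... | inj₁ ⊆ᶜ = inj₂ λ x jx → ≢false⇒≡true λ ix →
  true≢false (trans (sym (⊆ᶜ x (cong not ix))) (cong not jx))
... | inj₂ ⊆ᶜ = inj₁ λ x ix → ≢false⇒≡true λ jx →
  true≢false (trans (sym (⊆ᶜ x (cong not jx))) (cong not ix))

-- Moving to a larger column is `chainOfRows⇒ascent`; moving to a smaller one is the same ascent in
-- the complement.
chainOfRows⇒geodesicColumns : {P : Matrix m n} → DistinctRows P → ChainOfRows P →
                              Geodesic P → Geodesic (P ᵀ)
chainOfRows⇒geodesicColumns {P = P} distinctRows chain geodesic x y i differ with P i x in ix | P i y in iy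
... | true  | true  = contradiction refl differ
... | false | false = contradiction refl differ
... | false | true  = chainOfRows⇒ascent distinctRows chain geodesic i x y ix iy
... | true  | false
  with chainOfRows⇒ascent (λ i j eq → distinctRows i j (not-injective ∘ eq)) (chainOfRows-complement {P = P} chain)
         (geodesic-complement geodesic) i x y (cong not ix) (cong not iy)
...   | z , k , (change , agree) , toward =
  z , k , (change ∘ cong not , λ c c≢k → not-injective (agree c c≢k)) , toward ∘ cong not

⊆⇒∣─∣≡hamming : (A B : Subset n) → A ⊆ B → ∣ B ─ A ∣ ≡ hamming (Vec.lookup A) (Vec.lookup B)
⊆⇒∣─∣≡hamming [] [] _ = refl
⊆⇒∣─∣≡hamming (true  ∷ A) (true  ∷ B) A⊆B = ⊆⇒∣─∣≡hamming A B (drop-∷-⊆ A⊆B)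
⊆⇒∣─∣≡hamming (true  ∷ A) (false ∷ B) A⊆B = contradiction (⊆⇒ A⊆B zero refl) λ ()
⊆⇒∣─∣≡hamming (false ∷ A) (true  ∷ B) A⊆B = cong suc (⊆⇒∣─∣≡hamming A B (drop-∷-⊆ A⊆B))
⊆⇒∣─∣≡hamming (false ∷ A) (false ∷ B) A⊆B = ⊆⇒∣─∣≡hamming A B (drop-∷-⊆ A⊆B)

hamming≡0⇒≗ : {f g : Fin n → Bool} → hamming f g ≡ 0 → f ≗ g
hamming≡0⇒≗ {f = f} {g} eq x = decidable-stable (f x ≟ᵇ g x) λ differ → hamming-≢ f g x differ eq

hamming≡1⇒flip : {f g : Fin n → Bool} → hamming f g ≡ 1 → ∃ λ b → FlipAt f b g
hamming≡1⇒flip {suc n} {f} {g} eq with f zero ≟ᵇ g zero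
... | no differ rewrite xor-≢ differ = zero , differ ,
  λ { zero 0≢0 → contradiction refl 0≢0 ; (suc c) _ → hamming≡0⇒≗ (ℕ.suc-injective eq) c }
... | yes same rewrite xor-≡ same with hamming≡1⇒flip {f = f ∘ suc} {g ∘ suc} eq
...   | b , change , agree = suc b , change ,
  λ { zero _ → same ; (suc c) c≢b → agree c (c≢b ∘ cong suc) }

step⇒flip : {A B : Subset n} → A ⊆ B → ∣ B ─ A ∣ ≡ 1 →
            ∃ λ b → FlipAt (Vec.lookup A) b (Vec.lookup B) × Vec.lookup A b ≡ false
step⇒flip {A = A} {B} A⊆B ∣B─A∣≡1
  with hamming≡1⇒flip {f = Vec.lookup A} {Vec.lookup B} (trans (sym (⊆⇒∣─∣≡hamming A B A⊆B)) ∣B─A∣≡1)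
... | b , flip = b , flip , ≢true⇒≡false λ Ab → proj₁ flip (trans Ab (sym (⊆⇒ A⊆B b Ab)))

fullChain⇒geodesic×chain : (F : Family n) → FullChain F → Geodesic (incidence F) × ChainOfRows (incidence F)
fullChain⇒geodesic×chain {n} F (As , As↭F , linked) = geodesic , chain
  where
  Step : Subset n → Subset n → Set
  Step A B = A ⊆ B × ∣ B ─ A ∣ ≡ 1

  ∈As : ∀ i → member F i ∈ˡ As
  ∈As i = ∈-resp-↭ (↭-sym As↭F) (∈-lookup i)

  sub : ∀ Bs → AllPairs _⊆_ Bs → ∀ {A B} → A ∈ˡ Bs → B ∈ˡ Bs → A ⊆ B ⊎ B ⊆ A
  sub (_ ∷ _) (below ∷ _) (here refl) (here refl) = inj₁ λ x∈ → x∈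
  sub (_ ∷ _) (below ∷ _) (here refl) (there B∈) = inj₁ (All.lookup below B∈)
  sub (_ ∷ _) (below ∷ _) (there A∈) (here refl) = inj₂ (All.lookup below A∈)
  sub (_ ∷ Bs) (_ ∷ pairs) (there A∈) (there B∈) = sub Bs pairs A∈ B∈

  pairs : ∀ {Bs} → Linked Step Bs → AllPairs _⊆_ Bs
  pairs linked = Linked⇒AllPairs ⊆-trans (Linked.map (λ (A⊆B , _) {x} → A⊆B {x}) linked)

  chain : ChainOfRows (incidence F)
  chain i j with sub As (pairs linked) (∈As i) (∈As j)
  ... | inj₁ i⊆j = inj₁ (⊆⇒ i⊆j)
  ... | inj₂ j⊆i = inj₂ (⊆⇒ j⊆i)

  Toward : Subset n → Subset n → List (Subset n) → Set
  Toward A B Bs = ∃₂ λ K b → K ∈ˡ Bs × FlipAt (Vec.lookup A) b (Vec.lookup K) ×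
                             Vec.lookup A b ≢ Vec.lookup B b

  walk : ∀ Bs → Linked Step Bs → ∀ {A B} → A ∈ˡ Bs → B ∈ˡ Bs → ∀ x →
         Vec.lookup A x ≢ Vec.lookup B x → Toward A B Bs
  walk (A ∷ []) _ (here refl) (here refl) x differ = contradiction refl differ
  walk (A ∷ B ∷ Bs) linked (here refl) (here refl) x differ = contradiction refl differ
  walk (A ∷ K ∷ Bs) (step ∷ linked) {B = B} (here refl) (there B∈) x differ
    with step⇒flip (proj₁ step) (proj₂ step)
  ... | b , flip , Ab = K , b , there (here refl) , flip , λ eq → proj₁ flip (trans eq (Bb B∈ eq))
    where
    Kb : Vec.lookup K b ≡ true
    Kb = ≢false⇒≡true λ eq → proj₁ flip (trans Ab (sym eq))
    Bb : B ∈ˡ K ∷ Bs → Vec.lookup A b ≡ Vec.lookup B b → Vec.lookup B b ≡ Vec.lookup K b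
    Bb (here refl) _ = refl
    Bb (there B∈Bs) eq = trans (⊆⇒ (All.lookup (AllPairs.head (pairs linked)) B∈Bs) b Kb) (sym Kb)
  -- Here `A` comes after `B`. If `A` is `K`, the step goes back to `B`; otherwise a step from `A`
  -- towards `K` removes an element outside `K`, hence outside `B`.
  walk (B ∷ K ∷ Bs) (step ∷ linked) {A} (there A∈) (here refl) x differ
    with ≗⊎≢ (Vec.lookup A) (Vec.lookup K)
  ... | inj₁ same with refl ← subset-ext {A = A} {K} same with step⇒flip (proj₁ step) (proj₂ step)
  ...   | b , flip , _ = B , b , here refl , flipAt-sym flip , ≢-sym (proj₁ flip)
  walk (B ∷ K ∷ Bs) (step ∷ linked) {A} (there A∈) (here refl) x differ | inj₂ (y , differ′)
    with walk (K ∷ Bs) linked A∈ (here refl) y differ′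
  ... | L , b , L∈ , flip , toward = L , b , there L∈ , flip ,
    λ eq → toward (trans Ab (sym (⊆⇒ (proj₁ step) b (trans (sym eq) Ab))))
    where
    K⊆A : K ⊆ A
    K⊆A = above A∈
      where
      above : ∀ {A} → A ∈ˡ K ∷ Bs → K ⊆ A
      above (here refl)  x∈ = x∈
      above (there A∈Bs) = All.lookup (AllPairs.head (pairs linked)) A∈Bs

    Ab : Vec.lookup A b ≡ true
    Ab = ≢false⇒≡true λ eq → toward (trans eq
      (sym (≢true⇒≡false λ Kb → true≢false (trans (sym (⊆⇒ K⊆A b Kb)) eq))))
  walk (_ ∷ K ∷ Bs) (_ ∷ linked) (there A∈) (there B∈) x differ with walk (K ∷ Bs) linked A∈ B∈ x differ
  ... | L , b , L∈ , flip , toward = L , b , there L∈ , flip , toward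

  geodesic : Geodesic (incidence F)
  geodesic i j x differ with walk As linked (∈As i) (∈As j) x differ
  ... | K , b , K∈ , flip , toward with ∈⇒member F (∈-resp-↭ As↭F K∈)
  ...   | k , refl = k , b , flip , toward

doubleton-⊆⇒2≤length : {A : Set} {x y : A} {xs : List A} → x ≢ y → x ∈ˡ xs → y ∈ˡ xs → 2 ≤ length xs
doubleton-⊆⇒2≤length x≢y x∈ y∈ = unique-⊆⇒length≤ ((x≢y ∷ []) ∷ [] ∷ [])
  λ { (here refl) → x∈ ; (there (here refl)) → y∈ }

tripleton-⊆⇒3≤length : {A : Set} {x y z : A} {xs : List A} → x ≢ y → x ≢ z → y ≢ z →
                       x ∈ˡ xs → y ∈ˡ xs → z ∈ˡ xs → 3 ≤ length xs
tripleton-⊆⇒3≤length x≢y x≢z y≢z x∈ y∈ z∈ = unique-⊆⇒length≤ ((x≢y ∷ x≢z ∷ []) ∷ (y≢z ∷ []) ∷ [] ∷ [])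
  λ { (here refl) → x∈ ; (there (here refl)) → y∈ ; (there (there (here refl))) → z∈ }

-- Stars

-- An edge directed away from the empty row of `P`: an arc if `P` is the incidence matrix, a
-- reversed arc if `P` is its complement.
Up : Matrix m n → Fin m → Fin n → Fin m → Set
Up P i b j = FlipAt (P i) b (P j) × P i b ≡ false

flip-target : {P : Matrix m n} → DistinctRows P → {f : Fin n → Bool} → ∀ {b j j′} →
              FlipAt f b (P j) → FlipAt f b (P j′) → j ≡ j′
flip-target {P = P} distinctRows {f} {b} {j} {j′} (change , agree) (change′ , agree′) = distinctRows j j′ same
  where
  same : P j ≗ P j′
  same c with c ≟ᶠ b
  ... | yes refl = ≢∧≢⇒≡ (≢-sym change) change′
  ... | no c≢b = trans (sym (agree c c≢b)) (agree′ c c≢b)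

-- The matrix P is the incidence matrix of F or its complement, so that
-- the upward and the downward stars are treated alike.
module Star (F : Family n) (P : Matrix (size F) n) (distinctRows : DistinctRows P)
  (adj⇒flip : ∀ {i j} → Digraph.Adj (oneInclusion F) i j → ∃ λ b → FlipAt (P i) b (P j))
  (flip⇒adj : ∀ {i b j} → FlipAt (P i) b (P j) → Digraph.Adj (oneInclusion F) i j)
  where

  open Digraph (oneInclusion F)

  orient : ∀ {i b j} → FlipAt (P i) b (P j) → Up P i b j ⊎ Up P j b i
  orient {i} {b} {j} flip with P i b ≟ᵇ false
  ... | yes ib = inj₁ (flip , ib)
  ... | no ¬ib = inj₂ (flipAt-sym flip , ≢∧≢⇒≡ (≢-sym (proj₁ flip)) ¬ib)

  adj⇒up : ∀ {i j} → Adj i j → ∃ λ b → Up P i b j ⊎ Up P j b i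
  adj⇒up adj = let b , flip = adj⇒flip adj in b , orient flip

  up-label : ∀ {i b j} → Up P i b j → P j b ≡ true
  up-label ((change , _) , ib) = ≢false⇒≡true λ jb → change (trans ib (sym jb))

  up-⊆ : ∀ {i b j} → Up P i b j → ∀ x → P i x ≡ true → P j x ≡ true
  up-⊆ ((_ , agree) , ib) x ix = trans (sym (agree x λ { refl → true≢false (trans (sym ix) ib) })) ix

  adj∈neighbours : ∀ {i j} → Adj i j → j ∈ˡ filter (adj? i) (allFin (size F))
  adj∈neighbours {i} {j} = ∈-filter⁺ (adj? i) (∈-allFin j)

  EdgeUnique : Set
  EdgeUnique = ∀ {i i′ b j j′} → Up P i b j → Up P i′ b j′ → j ≡ j′

  up-source : ∀ {i i′ b j} → Up P i b j → Up P i′ b j → i ≡ i′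
  up-source (flip , _) (flip′ , _) = flip-target distinctRows (flipAt-sym flip) (flipAt-sym flip′)

  module FromSpider (geodesic : Geodesic P) (r : Fin (size F)) (empty : ConstantRow P false r)
    (columns : LaminarColumns P) (rows : LaminarColumns (P ᵀ)) where

    -- An `x` in `j′` but not in `j` would give columns `b` and `x` that meet in `j′` without being
    -- nested: `j` contains only `b` and `i′` only `x`.
    edge-unique-⊆ : ∀ {i i′ b j j′} → Up P i b j → Up P i′ b j′ →
                    (∀ x → P j x ≡ true → P j′ x ≡ true) → P j ≗ P j′
    edge-unique-⊆ {i} {i′} {b} {j} {j′} up up′@((_ , agree′) , i′b) j⊆j′ x with P j x in jx | P j′ x in j′x
    ... | true  | true  = refl
    ... | false | false = refl
    ... | true  | false = trans (sym (j⊆j′ x jx)) j′x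
    ... | false | true with columns j′ b x (up-label up′) j′x
    ...   | inj₁ b⊆x = trans (sym jx) (b⊆x j (up-label up))
    ...   | inj₂ x⊆b = contradiction
      (trans (sym (x⊆b i′ (trans (agree′ x (λ { refl → true≢false (trans (sym (up-label up)) jx) })) j′x))) i′b)
      true≢false

    edge-unique : EdgeUnique
    edge-unique {b = b} {j} {j′} up up′ with rows b j j′ (up-label up) (up-label up′)
    ... | inj₁ j⊆j′ = distinctRows j j′ (edge-unique-⊆ up up′ j⊆j′)
    ... | inj₂ j′⊆j = sym (distinctRows j′ j (edge-unique-⊆ up′ up j′⊆j))

    edge-unique-unoriented : ∀ {i i′ b j j′} → FlipAt (P i) b (P j) → FlipAt (P i′) b (P j′) →
                             (i ≡ i′ × j ≡ j′) ⊎ (i ≡ j′ × j ≡ i′)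
    edge-unique-unoriented flip flip′ with orient flip | orient flip′
    ... | inj₁ up | inj₁ up′ with refl ← edge-unique up up′ = inj₁ (up-source up up′ , refl)
    ... | inj₁ up | inj₂ up′ with refl ← edge-unique up up′ = inj₂ (up-source up up′ , refl)
    ... | inj₂ up | inj₁ up′ with refl ← edge-unique up up′ = inj₂ (refl , up-source up up′)
    ... | inj₂ up | inj₂ up′ with refl ← edge-unique up up′ = inj₁ (refl , up-source up up′)

    -- The firstIndex edge u — v of a cycle carries a label that occurs on no
    -- only-⊤ edge, so the rest of the cycle cannot undo the change.
    acyclic : ∀ u vs → ¬ Cycle u vs
    acyclic u [] (_ , _ , ())
    acyclic u (_ ∷ []) (_ , _ , s≤s ())
    acyclic u (v ∷ w ∷ ws) (uv ∷ vw ∷ linked , (u≢v ∷ u≢w ∷ u≢ws) ∷ (v≢w ∷ v≢ws) ∷ _ , _)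
      with adj⇒flip uv
    ... | b , flip = proj₁ flip (sym (trans
      (unchanged vw (λ (v≡u , _) → u≢v (sym v≡u)) (λ (_ , w≡u) → u≢w (sym w≡u)))
      (stay w ws linked u≢w v≢w u≢ws v≢ws)))
      where
      unchanged : ∀ {a c} → Adj a c → ¬ (a ≡ u × c ≡ v) → ¬ (a ≡ v × c ≡ u) → P a b ≡ P c b
      unchanged ac not-uv not-vu with adj⇒flip ac
      ... | e , flip′ with b ≟ᶠ e
      ...   | no b≢e = proj₂ flip′ b b≢e
      ...   | yes refl with edge-unique-unoriented flip′ flip
      ...     | inj₁ uv = contradiction uv not-uv
      ...     | inj₂ vu = contradiction vu not-vu

      stay : ∀ a ws → Linked Adj (a ∷ ws ∷ʳ u) → u ≢ a → v ≢ a → All (u ≢_) ws → All (v ≢_) ws →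
             P a b ≡ P u b
      stay a [] (au ∷ _) u≢a v≢a _ _ =
        unchanged au (λ (a≡u , _) → u≢a (sym a≡u)) (λ (a≡v , _) → v≢a (sym a≡v))
      stay a (c ∷ ws) (ac ∷ linked) u≢a v≢a (u≢c ∷ u≢ws) (v≢c ∷ v≢ws) = trans
        (unchanged ac (λ (a≡u , _) → u≢a (sym a≡u)) (λ (a≡v , _) → v≢a (sym a≡v)))
        (stay c ws linked u≢c v≢c u≢ws v≢ws)

    -- Since `v` is nonempty, rows just above it share an element and are nested by laminarity. With
    -- different labels each would contain an element that the other lacks.
    up-unique : ∀ {v e e′ a a′} → v ≢ r → Up P v e a → Up P v e′ a′ → a ≡ a′
    up-unique {v} {e} {e′} {a} {a′} v≢r up up′ with ≗⊎≢ (P v) (P r)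
    ... | inj₁ same = contradiction (distinctRows v r same) v≢r
    ... | inj₂ (y , differ) with e ≟ᶠ e′
    ...   | yes refl = flip-target distinctRows (proj₁ up) (proj₁ up′)
    ...   | no e≢e′ with rows y a a′ (up-⊆ up y vy) (up-⊆ up′ y vy)
      where
      vy : P v y ≡ true
      vy = ≢false⇒≡true λ vy → differ (trans vy (sym (empty y)))
    ...     | inj₁ a⊆a′ = contradiction
      (trans (sym (a⊆a′ e (up-label up))) (trans (sym (proj₂ (proj₁ up′) e e≢e′)) (proj₂ up))) true≢false
    ...     | inj₂ a′⊆a = contradiction
      (trans (sym (a′⊆a e′ (up-label up′))) (trans (sym (proj₂ (proj₁ up) e′ (≢-sym e≢e′))) (proj₂ up′)))
      true≢false

    -- The transposed argument: columns `e` and `e′` meet in `v`, while `a` contains only `e′` and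
    -- `a′` only `e`.
    down-unique : ∀ {v e e′ a a′} → Up P a e v → Up P a′ e′ v → a ≡ a′
    down-unique {v} {e} {e′} {a} {a′} up up′ with e ≟ᶠ e′
    ... | yes refl = up-source up up′
    ... | no e≢e′ with columns v e e′ (up-label up) (up-label up′)
    ...   | inj₁ e⊆e′ = contradiction
      (trans (sym (e⊆e′ a′ (trans (proj₂ (proj₁ up′) e e≢e′) (up-label up)))) (proj₂ up′)) true≢false
    ...   | inj₂ e′⊆e = contradiction
      (trans (sym (e′⊆e a (trans (proj₂ (proj₁ up) e′ (≢-sym e≢e′)) (up-label up′)))) (proj₂ up)) true≢false

    degree≤2 : ∀ v → v ≢ r → degree v ≤ 2
    degree≤2 v v≢r = at-most-two (filter (adj? v) (allFin (size F))) (filter⁺ (adj? v) (allFin⁺ (size F)))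
      λ a∈ → adj⇒up (proj₂ (∈-filter⁻ (adj? v) {xs = allFin (size F)} a∈))
      where
      Neighbour : Fin (size F) → Set
      Neighbour a = ∃ λ b → Up P v b a ⊎ Up P a b v

      pigeonhole : ∀ {a b c} → Neighbour a → Neighbour b → Neighbour c → a ≡ b ⊎ a ≡ c ⊎ b ≡ c
      pigeonhole (_ , inj₁ a) (_ , inj₁ b) _            = inj₁ (up-unique v≢r a b)
      pigeonhole (_ , inj₁ a) (_ , inj₂ _) (_ , inj₁ c) = inj₂ (inj₁ (up-unique v≢r a c))
      pigeonhole (_ , inj₁ _) (_ , inj₂ b) (_ , inj₂ c) = inj₂ (inj₂ (down-unique b c))
      pigeonhole (_ , inj₂ _) (_ , inj₁ b) (_ , inj₁ c) = inj₂ (inj₂ (up-unique v≢r b c))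
      pigeonhole (_ , inj₂ a) (_ , inj₁ _) (_ , inj₂ c) = inj₂ (inj₁ (down-unique a c))
      pigeonhole (_ , inj₂ a) (_ , inj₂ b) _            = inj₁ (down-unique a b)

      at-most-two : ∀ as → Unique as → (∀ {a} → a ∈ˡ as → Neighbour a) → length as ≤ 2
      at-most-two [] _ _ = z≤n
      at-most-two (_ ∷ []) _ _ = s≤s z≤n
      at-most-two (_ ∷ _ ∷ []) _ _ = s≤s (s≤s z≤n)
      at-most-two (a ∷ b ∷ c ∷ _) ((a≢b ∷ a≢c ∷ _) ∷ (b≢c ∷ _) ∷ _) neighbour
        with pigeonhole (neighbour (here refl)) (neighbour (there (here refl)))
                        (neighbour (there (there (here refl))))
      ... | inj₁ a≡b        = contradiction a≡b a≢b
      ... | inj₂ (inj₁ a≡c) = contradiction a≡c a≢c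
      ... | inj₂ (inj₂ b≡c) = contradiction b≡c b≢c

    first-step : ∀ i x → P i x ≡ true → ∃₂ λ b k → Up P r b k × P i b ≡ true
    first-step i x ix with geodesic r i x (λ eq → true≢false (trans (sym ix) (trans (sym eq) (empty x))))
    ... | k , b , flip , toward = b , k , (flip , empty b) ,
      ≢false⇒≡true λ ib → toward (trans (empty b) (sym ib))

    -- The first steps from the empty row towards two incomparable rows end in different neighbours:
    -- a shared label would lie in both rows and make them nested.
    2≤degree : ∀ {i j x y} → P i x ≡ true → P j x ≡ false → P j y ≡ true → P i y ≡ false → 2 ≤ degree r
    2≤degree {i} {j} {x} {y} ix jx jy iy with first-step i x ix | first-step j y jy
    ... | b , k , up , ib | c , l , up′ , jc = doubleton-⊆⇒2≤length k≢l
      (adj∈neighbours (flip⇒adj (proj₁ up))) (adj∈neighbours (flip⇒adj (proj₁ up′)))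
      where
      k≢l : k ≢ l
      k≢l refl with b ≟ᶠ c
      ... | no b≢c = true≢false (trans (sym (up-label up))
                       (trans (sym (proj₂ (proj₁ up′) b b≢c)) (empty b)))
      ... | yes refl with rows b i j ib jc
      ...   | inj₁ i⊆j = true≢false (trans (sym (i⊆j x ix)) jx)
      ...   | inj₂ j⊆i = true≢false (trans (sym (j⊆i y jy)) iy)

  module ToGeodesic (r : Fin (size F)) (empty : ConstantRow P false r)
    (z : Fin n) (emptyᶜ : ConstantRow (P ᵀ) false z) (connected : Connected)
    (radial : ∀ {i b j} → Up P i b j → ∃₂ λ d e → Distance i r d × Distance j r e × d < e)
    (edge-unique : EdgeUnique) (degree≤2 : ∀ v → v ≢ r → degree v ≤ 2) where

    -- A distance is obtained without searching for a shortest walk: `radial` supplies one at both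
    -- ends of the first edge of any walk to `r`.
    nearest : ∀ i → i ≢ r → ∃ λ d → Distance i r d
    nearest i i≢r with connected i r
    ... | _ , nil = contradiction refl i≢r
    ... | _ , cons adj _ with adj⇒up adj
    ...   | b , inj₁ up = let d , _ , distance , _ = radial up in d , distance
    ...   | b , inj₂ up = let _ , e , _ , distance , _ = radial up in e , distance

    -- The first edge of a shortest walk to `r` leads nearer to `r`; by `radial` an edge going up
    -- would lead farther away.
    predecessor : ∀ i → i ≢ r → ∃₂ λ k b → Up P k b i
    predecessor i i≢r with nearest i i≢r
    ... | _ , nil , _ = contradiction refl i≢r
    ... | suc d , cons {v = k} adj walk , minimal with adj⇒up adj
    ...   | b , inj₂ up = k , b , up
    ...   | b , inj₁ up with radial up
    ...     | d′ , e′ , (walk′ , _) , (_ , minimal′) , d′<e′ =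
      contradiction (minimal d′ walk′) (ℕ.<⇒≱ (ℕ.<-≤-trans d′<e′ (ℕ.m≤n⇒m≤1+n (minimal′ d walk))))

    -- The label of the root is junk.
    tree : Descent P r
    tree = record
      { label  = λ i → proj₁ (step i)
      ; parent = λ i → proj₁ (proj₂ (step i))
      ; flip   = λ {i} i≢r → flipAt-sym (proj₁ (proj₂ (proj₂ (step i)) i≢r))
      ; toward = λ {i} i≢r eq → true≢false (trans (sym (up-label (proj₂ (proj₂ (step i)) i≢r)))
                                              (trans eq (empty _)))
      }
      where
      step : ∀ i → ∃₂ λ b k → i ≢ r → Up P k b i
      step i with i ≟ᶠ r
      ... | yes i≡r = z , r , contradiction i≡r
      ... | no i≢r = let k , b , up = predecessor i i≢r in b , k , λ _ → up

    open Descent tree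

    parent-up : ∀ {i} → i ≢ r → Up P (parent i) (label i) i
    parent-up {i} i≢r with orient (flip i≢r)
    ... | inj₂ up = up
    ... | inj₁ (_ , i∌label) = contradiction (trans i∌label (sym (empty _))) (toward i≢r)

    injective : InjectiveLabels tree
    injective {i} {j} i≢r j≢r eq = edge-unique (parent-up i≢r)
      (subst (λ b → Up P (parent j) b j) (sym eq) (parent-up j≢r))

    open LabelledTree empty tree injective using (label∈⇒⊆; nonroot; label∉parent; label∈)

    rows-geodesic : Geodesic P
    rows-geodesic = LabelledTree.geodesic empty tree injective

    -- Two rows above `v` together with its parent would be three neighbours. The parent lacks
    -- `label v`, so it is neither of the upper two.
    up-unique : ∀ {v e e′ a a′} → v ≢ r → Up P v e a → Up P v e′ a′ → a ≡ a′
    up-unique {v} {a = a} {a′} v≢r up up′ with a ≟ᶠ a′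
    ... | yes a≡a′ = a≡a′
    ... | no a≢a′ = contradiction
      (tripleton-⊆⇒3≤length (above up) (above up′) a≢a′ (adj∈neighbours (flip⇒adj (flip v≢r)))
        (adj∈neighbours (flip⇒adj (proj₁ up))) (adj∈neighbours (flip⇒adj (proj₁ up′))))
      (ℕ.≤⇒≯ (degree≤2 v v≢r))
      where
      above : ∀ {e a} → Up P v e a → parent v ≢ a
      above up eq = true≢false (trans (sym (up-⊆ up _ (label∈ v≢r)))
        (trans (cong (λ k → P k (label v)) (sym eq)) (label∉parent v≢r)))

    -- A row with `label j` contains `j`, so the geodesic step from `j` towards it can only add an
    -- element.
    step-up : ∀ {j k} → j ≢ r → k ≢ j → P k (label j) ≡ true → ∃₂ λ b l → Up P j b l × P k b ≡ true
    step-up {j} {k} j≢r k≢j k∋label with ≗⊎≢ (P j) (P k)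
    ... | inj₁ same = contradiction (sym (distinctRows j k same)) k≢j
    ... | inj₂ (w , differ) with rows-geodesic j k w differ
    ...   | l , b , change , toward′ = b , l , (change , jb) ,
      ≢false⇒≡true λ kb → toward′ (trans jb (sym kb))
      where
      jb : P j b ≡ false
      jb = ≢true⇒≡false λ jb → toward′ (trans jb (sym (label∈⇒⊆ j≢r k k∋label b jb)))

    -- `b` labels the tree edge below some `l′`, and uniqueness of the edge labelled `b` identifies
    -- `l′` with `l`. So every upward edge is a tree edge.
    label-up : ∀ {j b l} → Up P j b l → l ≢ r × label l ≡ b
    label-up {j} {b} {l} up with label-onto l b (λ eq → true≢false (trans (sym (up-label up)) (trans eq (empty b))))
    ... | l′ , l′≢r , refl with refl ← edge-unique (parent-up l′≢r) up = l′≢r , refl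

    -- Removing the least row j with x from the column x leaves the column of
    -- the label of the unique row above j.
    column-step : ∀ x i → P i x ≡ true →
                  ∃₂ λ j y → j ≢ r × label j ≡ x × FlipAt ((P ᵀ) x) j ((P ᵀ) y)
    column-step x i ix with label-onto i x (λ eq → true≢false (trans (sym ix) (trans eq (empty x))))
    ... | j , j≢r , refl with any? (λ k → (P k x ≟ᵇ true) ×-dec ¬? (k ≟ᶠ j))
    ...   | no only-j = j , z , j≢r , refl ,
      (λ eq → true≢false (trans (sym (label∈ j≢r)) (trans eq (emptyᶜ j)))) ,
      λ k k≢j → trans (≢true⇒≡false λ kx → only-j (k , kx , k≢j)) (sym (emptyᶜ k))
    ...   | yes (k , kx , k≢j) with step-up j≢r k≢j kx
    ...     | b , l , up , kb = j , b , j≢r , refl ,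
      (λ eq → true≢false (trans (sym (label∈ j≢r)) (trans eq (proj₂ up)))) , agree
      where
      with-x : ∀ c → c ≢ j → P c (label j) ≡ true → P c b ≡ true
      with-x c c≢j cx with step-up j≢r c≢j cx
      ... | b′ , l′ , up′ , cb′ with refl ← up-unique j≢r up up′ =
        subst (λ b → P c b ≡ true) (trans (sym (proj₂ (label-up up′))) (proj₂ (label-up up))) cb′

      from-b : ∀ c → P c b ≡ true → P c (label j) ≡ true
      from-b c cb with label-up up
      ... | l≢r , refl = label∈⇒⊆ l≢r c cb (label j) (up-⊆ up (label j) (label∈ j≢r))

      agree : ∀ c → c ≢ j → P c (label j) ≡ P c b
      agree c c≢j with P c (label j) in cx
      ... | true  = sym (with-x c c≢j cx)
      ... | false = sym (≢true⇒≡false λ cb → true≢false (trans (sym (from-b c cb)) cx))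

    -- The label of a column is the row whose own label is that column. Row labels thus invert the
    -- column labels, which makes the latter injective, and `LabelledTree` applies to the transpose.
    columns-geodesic : ∀ {k} {Q : Matrix (size F) k} → SameColumns P Q → DistinctRows (Q ᵀ) → Geodesic (Q ᵀ)
    columns-geodesic {k} {Q} (to , from) distinctColumns =
      LabelledTree.geodesic {P = Q ᵀ} emptyʳ columnTree columns-injective
      where
      root : Fin k
      root = proj₁ (to z)

      emptyʳ : ∀ i → Q i root ≡ false
      emptyʳ i = trans (sym (proj₂ (to z) i)) (emptyᶜ i)

      element : Fin k → Fin n
      element y = proj₁ (from y)

      ∈element : ∀ y i → P i (element y) ≡ Q i y
      ∈element y = proj₂ (from y)

      step : ∀ y → ∃₂ λ j y′ → y ≢ root →
             j ≢ r × label j ≡ element y × FlipAt ((Q ᵀ) y) j ((Q ᵀ) y′) × Q j y ≡ true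
      step y with ≗⊎≢ ((Q ᵀ) y) ((Q ᵀ) root)
      ... | inj₁ same = r , root , contradiction (distinctColumns y root same)
      ... | inj₂ (i , differ) with column-step (element y) i
              (≢false⇒≡true λ iy → differ (trans (sym (∈element y i)) (trans iy (sym (emptyʳ i)))))
      ...   | j , w , j≢r , label≡ , (change , agree) = j , proj₁ (to w) , λ _ → j≢r , label≡ ,
        ((λ eq → change (trans (∈element y j) (trans eq (sym (proj₂ (to w) j))))) ,
          λ c c≢j → trans (sym (∈element y c)) (trans (agree c c≢j) (proj₂ (to w) c))) ,
        trans (sym (∈element y j)) (subst (λ x → P j x ≡ true) label≡ (label∈ j≢r))

      columnTree : Descent (Q ᵀ) root
      columnTree = record
        { label  = λ y → proj₁ (step y)
        ; parent = λ y → proj₁ (proj₂ (step y))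
        ; flip   = λ {y} y≢ → proj₁ (proj₂ (proj₂ (proj₂ (proj₂ (step y)) y≢)))
        ; toward = λ {y} y≢ eq → true≢false (trans (sym (proj₂ (proj₂ (proj₂ (proj₂ (proj₂ (step y)) y≢)))))
                                                   (trans eq (emptyʳ _)))
        }

      columns-injective : InjectiveLabels columnTree
      columns-injective {y} {y′} y≢ y′≢ eq = distinctColumns y y′ λ i →
        trans (sym (∈element y i)) (trans (cong (P i) same-element) (∈element y′ i))
        where
        same-element : element y ≡ element y′
        same-element = trans (sym (proj₁ (proj₂ (proj₂ (proj₂ (step y)) y≢))))
          (trans (cong label eq) (proj₁ (proj₂ (proj₂ (proj₂ (step y′)) y′≢))))

-- Well-graded systems and the three shapes

flipAt-complement⁺ : {f g : Fin n → Bool} {b : Fin n} → FlipAt f b g → FlipAt (not ∘ f) b (not ∘ g)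
flipAt-complement⁺ (change , agree) = change ∘ not-injective , λ c c≢b → cong not (agree c c≢b)

flipAt-complement⁻ : {f g : Fin n → Bool} {b : Fin n} → FlipAt (not ∘ f) b (not ∘ g) → FlipAt f b g
flipAt-complement⁻ (change , agree) = change ∘ cong not , λ c c≢b → not-injective (agree c c≢b)

geodesic-complement⁻ : {P : Matrix m n} → Geodesic (complement P) → Geodesic P
geodesic-complement⁻ geodesic i j x differ with geodesic i j x (differ ∘ not-injective)
... | k , b , flip , toward = k , b , flipAt-complement⁻ flip , toward ∘ cong not

hamming-flip-< : {f g h : Fin n → Bool} {b : Fin n} → FlipAt f b g → f b ≢ h b →
                 hamming g h < hamming f h
hamming-flip-< {h = h} flip toward = ℕ.≤-reflexive (sym (hamming-flip {h = h} flip toward))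

lookup-⊥ : ∀ (x : Fin n) → Vec.lookup ⊥ x ≡ false
lookup-⊥ x = lookup-replicate x false

lookup-⊤ : ∀ (x : Fin n) → Vec.lookup ⊤ x ≡ true
lookup-⊤ x = lookup-replicate x true

-- The failure of `ChainOfRows` in positive form; it provides the centre of a star with two
-- neighbours.
Crossing : Matrix m n → Set
Crossing P = ∃₂ λ i j → (∃ λ x → P i x ≡ true × P j x ≡ false) × (∃ λ y → P j y ≡ true × P i y ≡ false)

chainOfRows⊎crossing : (P : Matrix m n) → ChainOfRows P ⊎ Crossing P
chainOfRows⊎crossing P with any? (λ i → any? λ j →
  any? (λ x → (P i x ≟ᵇ true) ×-dec (P j x ≟ᵇ false)) ×-dec
  any? (λ y → (P j y ≟ᵇ true) ×-dec (P i y ≟ᵇ false)))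
... | yes crossing = inj₂ crossing
... | no none = inj₁ chain
  where
  chain : ChainOfRows P
  chain i j with ⊆⊎⊈ (P i) (P j) | ⊆⊎⊈ (P j) (P i)
  ... | inj₁ i⊆j | _        = inj₁ i⊆j
  ... | inj₂ _   | inj₁ j⊆i = inj₂ j⊆i
  ... | inj₂ i⊈j | inj₂ j⊈i = contradiction (i , j , i⊈j , j⊈i) none

module _ (F : Family n) where

  open Digraph (oneInclusion F)

  private
    P  = incidence F
    Pᶜ = complement (incidence F)

    distinctᶜ : DistinctRows Pᶜ
    distinctᶜ i j eq = incidence-distinct F i j (not-injective ∘ eq)

    adj⇒flipᶜ : ∀ {i j} → Adj i j → ∃ λ b → FlipAt (Pᶜ i) b (Pᶜ j)
    adj⇒flipᶜ adj = let b , flip = adj⇒flip F adj in b , flipAt-complement⁺ flip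

    flip⇒adjᶜ : ∀ {i b j} → FlipAt (Pᶜ i) b (Pᶜ j) → Adj i j
    flip⇒adjᶜ flip = flip⇒adj F (flipAt-complement⁻ flip)

    module Upward = Star F P (incidence-distinct F) (adj⇒flip F) (flip⇒adj F)
    module Downward = Star F Pᶜ distinctᶜ adj⇒flipᶜ flip⇒adjᶜ

    up⇒arc : ∀ {i b j} → Up P i b j → Arc i b j
    up⇒arc (flip , ib) = flip⇒arc F flip ib

    upᶜ⇒arc : ∀ {i b j} → Up Pᶜ i b j → Arc j b i
    upᶜ⇒arc up@(flip , _) =
      flip⇒arc F (flipAt-sym (flipAt-complement⁻ flip)) (not-injective (Downward.up-label up))

    arc⇒upᶜ : ∀ {i b j} → Arc i b j → Up Pᶜ j b i
    arc⇒upᶜ arc with arc⇒flip F arc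
    ... | flip , ib = flipAt-complement⁺ (flipAt-sym flip) ,
      cong not (≢false⇒≡true λ jb → proj₁ flip (trans ib (sym jb)))

    distance : WellGraded F → ∀ i j → Distance i j (hamming (P i) (P j))
    distance wellGraded i j = subst (Distance i j) (∣△∣≡hamming (member F i) (member F j)) (wellGraded i j)

  spider⇒upwardStarlike : WellGraded F → Spider P → Crossing P → UpwardStarlike F
  spider⇒upwardStarlike wellGraded ((r , empty) , (z , emptyᶜ) , columns , rows)
                        (i , j , (x , ix , jx) , (y , jy , iy)) =
    (r , subset-ext (λ x → trans (empty x) (sym (lookup-⊥ x))) ,
      ((((λ u v → _ , proj₁ (wellGraded u v)) , S.acyclic) , labels , S.2≤degree ix jx jy iy ,
        inj₁ source , S.degree≤2) , source)) ,
    z , λ A A∈F z∈A → let i , eq = ∈⇒member F A∈F in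
      true≢false (trans (sym ([]=⇒lookup z∈A)) (trans (cong (λ A → Vec.lookup A z) (sym eq)) (emptyᶜ i)))
    where
    module S = Upward.FromSpider (wellGraded⇒geodesic F wellGraded) r empty columns rows

    labels : DistinctLabels
    labels b arc arc′ with arc⇒flip F arc | arc⇒flip F arc′
    ... | up | up′ with refl ← S.edge-unique up up′ = Upward.up-source up up′ , refl

    source : Source r
    -- Distances are Hamming distances, and an arc adds an element that the empty row lacks.
    source w b v arc = _ , _ , distance wellGraded w r , distance wellGraded v r ,
      hamming-flip-< {h = P r} (flipAt-sym (proj₁ up)) λ vb≡rb →
        true≢false (trans (sym (Upward.up-label up)) (trans vb≡rb (empty b)))
      where up = arc⇒flip F arc

  spider⇒downwardStarlike : WellGraded F → Spider Pᶜ → Crossing Pᶜ → DownwardStarlike F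
  spider⇒downwardStarlike wellGraded ((r , empty) , (z , emptyᶜ) , columns , rows)
                          (i , j , (x , ix , jx) , (y , jy , iy)) =
    (r , subset-ext (λ x → trans (not-injective (empty x)) (sym (lookup-⊤ x))) ,
      ((((λ u v → _ , proj₁ (wellGraded u v)) , S.acyclic) , labels , S.2≤degree ix jx jy iy ,
        inj₂ sink , S.degree≤2) , sink)) ,
    z , λ A A∈F → let i , eq = ∈⇒member F A∈F in
      subst (z ∈_) eq (lookup⇒[]= z (member F i) (not-injective (emptyᶜ i)))
    where
    module S = Downward.FromSpider (geodesic-complement (wellGraded⇒geodesic F wellGraded)) r empty columns rows

    labels : DistinctLabels
    labels b arc arc′ with arc⇒upᶜ arc | arc⇒upᶜ arc′
    ... | up | up′ with refl ← S.edge-unique up up′ = refl , Downward.up-source up up′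

    sink : Sink r
    sink w b v arc = _ , _ , distance wellGraded w r , distance wellGraded v r ,
      hamming-flip-< {h = P r} (proj₁ (arc⇒flip F arc)) λ wb≡rb →
        true≢false (trans (sym (Downward.up-label (arc⇒upᶜ arc))) (trans (cong not wb≡rb) (empty b)))

  wellGraded⇒shape : Fin (size F) → SelfAndDual WellGraded F → FullChain F ⊎ UpwardStarlike F ⊎ DownwardStarlike F
  wellGraded⇒shape i (wellGraded , wellGradedᵈ)
    with classification-same (sameColumns-dual F) (dual-classification F i wellGraded wellGradedᵈ)
  ... | inj₁ chain = inj₁ (chainOfRows⇒fullChain F (wellGraded⇒geodesic F wellGraded) chain)
  ... | inj₂ (inj₁ spider) with chainOfRows⊎crossing P
  ...   | inj₁ chain = inj₁ (chainOfRows⇒fullChain F (wellGraded⇒geodesic F wellGraded) chain)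
  ...   | inj₂ crossing = inj₂ (inj₁ (spider⇒upwardStarlike wellGraded spider crossing))
  wellGraded⇒shape i (wellGraded , wellGradedᵈ) | inj₂ (inj₂ spider) with chainOfRows⊎crossing Pᶜ
  ...   | inj₁ chain = inj₁ (chainOfRows⇒fullChain F (wellGraded⇒geodesic F wellGraded)
                         (chainOfRows-complement⁻ {P = P} chain))
  ...   | inj₂ crossing = inj₂ (inj₂ (spider⇒downwardStarlike wellGraded spider crossing))

  fullChain⇒wellGraded : FullChain F → SelfAndDual WellGraded F
  fullChain⇒wellGraded fullChain with fullChain⇒geodesic×chain F fullChain
  ... | geodesic , chain = geodesic⇒wellGraded F geodesic ,
    geodesic⇒wellGraded (dual F)
      (geodesic-dual F (chainOfRows⇒geodesicColumns (incidence-distinct F) chain geodesic))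

  upwardStarlike⇒wellGraded : UpwardStarlike F → SelfAndDual WellGraded F
  upwardStarlike⇒wellGraded ((r , r≡⊥ , ((connected , _) , labels , _ , _ , degree≤2) , source) , z , z∉) =
    geodesic⇒wellGraded F T.rows-geodesic ,
    geodesic⇒wellGraded (dual F) (T.columns-geodesic (sameColumns-dual F) (incidence-distinct (dual F)))
    where
    empty : ConstantRow P false r
    empty x = trans (cong (λ A → Vec.lookup A x) r≡⊥) (lookup-⊥ x)

    emptyᶜ : ConstantRow (P ᵀ) false z
    emptyᶜ i = ∉⇒false (z∉ (member F i) (∈-lookup i))

    radial : ∀ {i b j} → Up P i b j → ∃₂ λ d e → Distance i r d × Distance j r e × d < e
    radial up = source _ _ _ (up⇒arc up)

    edge-unique : Upward.EdgeUnique
    edge-unique up up′ = proj₂ (labels _ (up⇒arc up) (up⇒arc up′))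

    module T = Upward.ToGeodesic r empty z emptyᶜ connected radial edge-unique degree≤2

  downwardStarlike⇒wellGraded : DownwardStarlike F → SelfAndDual WellGraded F
  downwardStarlike⇒wellGraded ((r , r≡⊤ , ((connected , _) , labels , _ , _ , degree≤2) , sink) , z , z∈) =
    geodesic⇒wellGraded F (geodesic-complement⁻ T.rows-geodesic) ,
    geodesic⇒wellGraded (dual F) (geodesic-complement⁻
      (T.columns-geodesic (sameColumns-complement (sameColumns-dual F))
        λ y y′ eq → incidence-distinct (dual F) y y′ (not-injective ∘ eq)))
    where
    empty : ConstantRow Pᶜ false r
    empty x = cong not (trans (cong (λ A → Vec.lookup A x) r≡⊤) (lookup-⊤ x))

    emptyᶜ : ConstantRow (Pᶜ ᵀ) false z
    emptyᶜ i = cong not ([]=⇒lookup (z∈ (member F i) (∈-lookup i)))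

    radial : ∀ {i b j} → Up Pᶜ i b j → ∃₂ λ d e → Distance i r d × Distance j r e × d < e
    radial up = let d , e , dᵂ , eᵂ , e<d = sink _ _ _ (upᶜ⇒arc up) in e , d , eᵂ , dᵂ , e<d

    edge-unique : Downward.EdgeUnique
    edge-unique up up′ = proj₁ (labels _ (upᶜ⇒arc up) (upᶜ⇒arc up′))

    module T = Downward.ToGeodesic r empty z emptyᶜ connected radial edge-unique degree≤2

firstIndex : (F : Family n) → NonEmpty F → Fin (size F)
firstIndex record { members = [] }    nonEmpty = contradiction refl nonEmpty
firstIndex record { members = _ ∷ _ } _        = zero

at-most : (F : Family n) (As : List (Subset n)) → (∀ {A} → A ∈ᶠ F → A ∈ˡ As) → size F ≤ length As
at-most F As F⊆As = unique-⊆⇒length≤ (distinct F) F⊆As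

inhabited : (F : Family n) → Fin (size F) → 1 ≤ size F
inhabited record { members = _ ∷ _ } _ = s≤s z≤n

singleton-size : (F : Family n) {A : Subset n} → Fin (size F) → (∀ {B} → B ∈ᶠ F → B ≡ A) → size F ≡ 1
singleton-size F {A} i only-A =
  ℕ.≤-antisym (at-most F (A ∷ []) (here ∘ only-A)) (inhabited F i)

size≡1⇒unique : m ≡ 1 → (i j : Fin m) → i ≡ j
size≡1⇒unique refl zero zero = refl

-- VC-dimension

∈ᶠ? : (F : Family n) (A : Subset n) → Dec (A ∈ᶠ F)
∈ᶠ? F A = ∈ˡ? _≟ˢ_ A (members F)

shattered? : (F : Family n) (Y : Subset n) → Dec (Shattered F Y)
shattered? F Y with anySubset? (λ Z → (Z ⊆? Y) ×-dec ¬? (∈ᶠ? (trace F Y) Z))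
... | yes (Z , Z⊆Y , Z∉) = no λ shattered → Z∉ (Equivalence.from (shattered Z) Z⊆Y)
... | no none = yes λ Z → mk⇔ (to Z) λ Z⊆Y → decidable-stable (∈ᶠ? (trace F Y) Z) λ Z∉ → none (Z , Z⊆Y , Z∉)
  where
  to : ∀ Z → Z ∈ᶠ trace F Y → Z ⊆ Y
  to Z Z∈ with ∈-trace⁻ F Y Z∈
  ... | i , refl = p∩q⊆q (member F i) Y

-- The bound is lowered from `n` until it is attained; at zero the empty set attains it.
hasVCDim : (F : Family n) → Fin (size F) → ∃ (HasVCDim F)
hasVCDim {n} F i = search n λ Y _ → ∣p∣≤n Y
  where
  search : ∀ d → (∀ Y → Shattered F Y → ∣ Y ∣ ≤ d) → ∃ (HasVCDim F)
  search zero bound = 0 , (⊥ , ⊥-shattered , ∣⊥∣≡0 n) , bound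
    where
    ⊥-shattered : Shattered F ⊥
    ⊥-shattered = shatters⇒shattered F ⊥ λ Z → i , λ x x∈⊥ →
      contradiction (trans (sym x∈⊥) (lookup-⊥ x)) true≢false
  search (suc d) bound with anySubset? (λ Y → shattered? F Y ×-dec (∣ Y ∣ ℕ.≟ suc d))
  ... | yes (Y , shattered , ∣Y∣≡) = suc d , (Y , shattered , ∣Y∣≡) , bound
  ... | no none = search d λ Y shattered → s≤s⁻¹ (ℕ.≤∧≢⇒< (bound Y shattered)
                    λ ∣Y∣≡ → none (Y , shattered , ∣Y∣≡))

-- Two members that differ at `x` would shatter `⁅ x ⁆`.
vcDim0⇒size≡1 : (F : Family n) → Fin (size F) → HasVCDim F 0 → size F ≡ 1
vcDim0⇒size≡1 F i (_ , bound) = singleton-size F i only-i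
  where
  only-i : ∀ {A} → A ∈ᶠ F → A ≡ member F i
  only-i A∈F with ∈⇒member F A∈F
  ... | j , refl with ≗⊎≢ (incidence F j) (incidence F i)
  ...   | inj₁ same = subset-ext same
  ...   | inj₂ (x , differ) =
    contradiction (bound ⁅ x ⁆ (shatters⇒shattered F ⁅ x ⁆ pick)) (ℕ.<⇒≱ (ℕ.≤-reflexive (sym (∣⁅x⁆∣≡1 x))))
    where
    pick : Shatters (incidence F) (Vec.lookup ⁅ x ⁆)
    pick Z with incidence F i x ≟ᵇ Z x
    ... | yes eq = i , λ y y∈ → subst (λ y → incidence F i y ≡ Z y)
      (sym (x∈⁅y⁆⇒x≡y x (lookup⇒[]= y ⁅ x ⁆ y∈))) eq
    ... | no neq = j , λ y y∈ → subst (λ y → incidence F j y ≡ Z y)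
      (sym (x∈⁅y⁆⇒x≡y x (lookup⇒[]= y ⁅ x ⁆ y∈))) (≢∧≢⇒≡ differ neq)

-- Maximum systems

trace-⊤-size : (F : Family n) → size (trace F ⊤) ≡ size F
trace-⊤-size F = ℕ.≤-antisym (at-most (trace F ⊤) (members F) trace⊆F)
                              (at-most F (members (trace F ⊤)) F⊆trace)
  where
  trace⊆F : ∀ {A} → A ∈ᶠ trace F ⊤ → A ∈ᶠ F
  trace⊆F A∈ with ∈-trace⁻ F ⊤ A∈
  ... | i , refl = subst (_∈ᶠ F) (sym (∩-identityʳ (member F i))) (∈-lookup i)

  F⊆trace : ∀ {A} → A ∈ᶠ F → A ∈ᶠ trace F ⊤
  F⊆trace A∈F with ∈⇒member F A∈F
  ... | i , refl = subst (_∈ᶠ trace F ⊤) (∩-identityʳ (member F i)) (∈-trace⁺ F ⊤ i)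

-- In positive VC-dimension the binomial sum for the whole domain contains both `n C 0` and `n C 1`.
maximum⇒size : (F : Family n) → Maximum F → ∀ {d} → HasVCDim F (suc d) → suc n ≤ size F
maximum⇒size {n} F maximum {d} dim = begin
  suc n                              ≡⟨ cong suc (nC1≡n n) ⟨
  1 + n C 1                          ≤⟨ s≤s (ℕ.m≤m+n _ _) ⟩
  sum (map (n C_) (upTo (suc (suc d)))) ≡⟨ cong (λ k → sum (map (k C_) (upTo (suc (suc d))))) (∣⊤∣≡n n) ⟨
  sum (map (∣ ⊤ {n} ∣ C_) (upTo (suc (suc d)))) ≡⟨ maximum (suc d) dim ⊤ ⟨
  size (trace F ⊤)                   ≡⟨ trace-⊤-size F ⟩
  size F                             ∎
  where open ℕ.≤-Reasoning

dual-size≤ : (F : Family n) → size (dual F) ≤ n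
dual-size≤ {n} F = ℕ.≤-trans
  (at-most (dual F) (tabulate (dualSet F)) (∈-fromList⁻ (tabulate (dualSet F))))
  (ℕ.≤-reflexive (length-tabulate (dualSet F)))

dual-size≡1⇒constant : (F : Family n) → Fin n → size (dual F) ≡ 1 → ∀ {A} → A ∈ᶠ F → A ≡ ⊥ ⊎ A ≡ ⊤
dual-size≡1⇒constant F x size≡1 A∈F with ∈⇒member F A∈F
... | i , refl = by-value (incidence F i x) refl
  where
  constant : ∀ y → incidence F i y ≡ incidence F i x
  constant y with dualIndex F x | dualIndex F y
  ... | x′ , atx | y′ , aty with refl ← size≡1⇒unique size≡1 x′ y′ = trans (sym (aty i)) (atx i)

  by-value : ∀ a → incidence F i x ≡ a → member F i ≡ ⊥ ⊎ member F i ≡ ⊤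
  by-value false ix = inj₁ (subset-ext λ y → trans (constant y) (trans ix (sym (lookup-⊥ y))))
  by-value true  ix = inj₂ (subset-ext λ y → trans (constant y) (trans ix (sym (lookup-⊤ y))))

selfAndDualMaximum⇒ : (F : Family n) → NonEmpty F → SelfAndDual Maximum F →
           size F ≡ 1 ⊎ (n ≡ 1 × IsEmptyAndFull F)
selfAndDualMaximum⇒ {n} F nonEmpty (maximum , maximumᵈ) with hasVCDim F (firstIndex F nonEmpty)
... | zero , dim = inj₁ (vcDim0⇒size≡1 F (firstIndex F nonEmpty) dim)
... | suc d , dim@((Y , _ , ∣Y∣≡) , _) = inj₂ (dual-case n refl)
  where
  1+n≤size : suc n ≤ size F
  1+n≤size = maximum⇒size F maximum dim

  dual-case : ∀ k → n ≡ k → n ≡ 1 × IsEmptyAndFull F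
  dual-case zero refl = contradiction (∣p∣≤n Y) (ℕ.<⇒≱ (ℕ.≤-trans (s≤s z≤n) (ℕ.≤-reflexive (sym ∣Y∣≡))))
  dual-case (suc k) refl with hasVCDim (dual F) (proj₁ (dualIndex F zero))
  ... | suc _ , dimᵈ = contradiction
    (ℕ.≤-trans (maximum⇒size (dual F) maximumᵈ dimᵈ) (dual-size≤ F))
    (ℕ.<⇒≱ (ℕ.≤-trans 1+n≤size (ℕ.n≤1+n _)))
  -- The dual has a single member, so all columns agree and every member is `⊥` or `⊤`. Then
  -- `suc n ≤ size F ≤ 2` forces a one-point domain and the presence of both.
  ... | zero , dimᵈ = n≡1 , λ A → mk⇔ ⊥⊎⊤ λ
      { (inj₁ refl) → decidable-stable (∈ᶠ? F ⊥) (λ ⊥∉F → too-small λ B∈F → only-⊤ ⊥∉F B∈F)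
      ; (inj₂ refl) → decidable-stable (∈ᶠ? F ⊤) (λ ⊤∉F → too-small λ B∈F → only-⊥ ⊤∉F B∈F) }
    where
    ⊥⊎⊤ : ∀ {A} → A ∈ᶠ F → A ≡ ⊥ ⊎ A ≡ ⊤
    ⊥⊎⊤ = dual-size≡1⇒constant F zero (vcDim0⇒size≡1 (dual F) (proj₁ (dualIndex F zero)) dimᵈ)

    size≤2 : size F ≤ 2
    size≤2 = at-most F (⊥ ∷ ⊤ ∷ []) (list ∘ ⊥⊎⊤)
      where
      list : ∀ {A} → A ≡ ⊥ ⊎ A ≡ ⊤ → A ∈ˡ ⊥ ∷ ⊤ ∷ []
      list (inj₁ eq) = here eq
      list (inj₂ eq) = there (here eq)

    n≡1 : suc k ≡ 1
    n≡1 = ℕ.≤-antisym (s≤s⁻¹ (ℕ.≤-trans 1+n≤size size≤2)) (s≤s z≤n)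

    too-small : ∀ {A} → ¬ (∀ {B} → B ∈ᶠ F → B ≡ A)
    too-small only = ℕ.<⇒≱ (ℕ.≤-trans (s≤s (s≤s z≤n)) 1+n≤size)
      (ℕ.≤-reflexive (singleton-size F (firstIndex F nonEmpty) only))

    only-⊤ : ¬ ⊥ ∈ᶠ F → ∀ {B} → B ∈ᶠ F → B ≡ ⊤
    only-⊤ ⊥∉F B∈F with ⊥⊎⊤ B∈F
    ... | inj₁ refl = contradiction B∈F ⊥∉F
    ... | inj₂ B≡⊤ = B≡⊤

    only-⊥ : ¬ ⊤ ∈ᶠ F → ∀ {B} → B ∈ᶠ F → B ≡ ⊥
    only-⊥ ⊤∉F B∈F with ⊥⊎⊤ B∈F
    ... | inj₂ refl = contradiction B∈F ⊤∉F
    ... | inj₁ B≡⊥ = B≡⊥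

trace-inhabited : (F : Family n) (Y : Subset n) → Fin (size F) → Fin (size (trace F Y))
trace-inhabited F Y i = index (∈-trace⁺ F Y i)

shattered⇒inhabited : (F : Family n) {Y : Subset n} → Shattered F Y → Fin (size F)
shattered⇒inhabited F {Y} shattered = proj₁ (shattered⇒shatters F Y shattered λ _ → false)

size≡1⇒maximum : (F : Family n) → size F ≡ 1 → Maximum F
size≡1⇒maximum {n} F size≡1 d ((Y₀ , shattered , ∣Y₀∣≡d) , _) Y =
  trans (singleton-size (trace F Y) (trace-inhabited F Y i) only)
    (sym (cong (λ k → sum (map (∣ Y ∣ C_) (upTo (suc k)))) d≡0))
  where
  i : Fin (size F)
  i = shattered⇒inhabited F shattered

  only : ∀ {Y Z} → Z ∈ᶠ trace F Y → Z ≡ member F i ∩ Y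
  only {Y} Z∈ with ∈-trace⁻ F Y Z∈
  ... | j , refl = cong (λ j → member F j ∩ Y) (size≡1⇒unique size≡1 j i)

  -- Both `Y₀` and `⊥` belong to the trace on the shattered set `Y₀`, which has a single member.
  Y₀≡⊥ : Y₀ ≡ ⊥
  Y₀≡⊥ = trans (only (Equivalence.from (shattered Y₀) ⊆-refl))
               (sym (only (Equivalence.from (shattered ⊥) (⊆-min Y₀))))

  d≡0 : d ≡ 0
  d≡0 = trans (sym ∣Y₀∣≡d) (trans (cong ∣_∣ Y₀≡⊥) (∣⊥∣≡0 n))

-- On one point, VC-dimension 0 means a single member and VC-dimension 1 means the full power set,
-- whose traces have 1 and 2 members.
singletonDomain⇒maximum : (F : Family 1) → Maximum F
singletonDomain⇒maximum F d dim@(((false ∷ []) , shattered , refl) , _) =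
  size≡1⇒maximum F (vcDim0⇒size≡1 F (shattered⇒inhabited F shattered) dim) d dim
singletonDomain⇒maximum F d dim@(((true ∷ []) , shattered , refl) , _) (false ∷ []) =
  singleton-size (trace F ⊥) (trace-inhabited F ⊥ (shattered⇒inhabited F shattered)) only-⊥
  where
  only-⊥ : ∀ {Z} → Z ∈ᶠ trace F ⊥ → Z ≡ ⊥
  only-⊥ Z∈ with ∈-trace⁻ F ⊥ Z∈
  ... | i , refl = ∩-zeroʳ (member F i)
singletonDomain⇒maximum F d dim@(((true ∷ []) , shattered , refl) , _) (true ∷ []) =
  ℕ.≤-antisym (at-most (trace F ⊤) (⊤ ∷ ⊥ ∷ []) λ {Z} _ → listed Z)
    (doubleton-⊆⇒2≤length {x = ⊤} {⊥} (λ ()) (Equivalence.from (shattered ⊤) ⊆-refl)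
                                        (Equivalence.from (shattered ⊥) (⊆-min ⊤)))
  where
  listed : (Z : Subset 1) → Z ∈ˡ ⊤ ∷ ⊥ ∷ []
  listed (true  ∷ []) = here refl
  listed (false ∷ []) = there (here refl)

-- Duality exchanges the two cases: a single member makes the dual domain one point, and a one-point
-- domain makes the dual a single member.
⇒selfAndDualMaximum : (F : Family n) → size F ≡ 1 ⊎ n ≡ 1 → SelfAndDual Maximum F
⇒selfAndDualMaximum F (inj₁ size≡1) = size≡1⇒maximum F size≡1 , on-singleton size≡1 (dual F)
  where
  on-singleton : ∀ {k} → k ≡ 1 → (G : Family k) → Maximum G
  on-singleton refl = singletonDomain⇒maximum
⇒selfAndDualMaximum F (inj₂ refl) = singletonDomain⇒maximum F , size≡1⇒maximum (dual F) refl

corollary4p13 : ∀ (n : ℕ) (F : Family n) → NonEmpty F →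
    ((SelfAndDual Extremal F ⇔ SelfAndDual WellGraded F) ×
    (SelfAndDual WellGraded F ⇔ (FullChain F ⊎ UpwardStarlike F ⊎ DownwardStarlike F))) ×
    (SelfAndDual Maximum F ⇔ (size F ≡ 1 ⊎ (n ≡ 1 × IsEmptyAndFull F)))
corollary4p13 n F nonEmpty =
  (mk⇔ (λ (extremal , extremalᵈ) → extremal⇒wellGraded F extremal , extremal⇒wellGraded (dual F) extremalᵈ)
       (wellGraded⇒extremal F (firstIndex F nonEmpty)) ,
   mk⇔ (wellGraded⇒shape F (firstIndex F nonEmpty))
       λ { (inj₁ chain)       → fullChain⇒wellGraded F chain
         ; (inj₂ (inj₁ up))   → upwardStarlike⇒wellGraded F up
         ; (inj₂ (inj₂ down)) → downwardStarlike⇒wellGraded F down }) ,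
  mk⇔ (selfAndDualMaximum⇒ F nonEmpty)
      λ { (inj₁ size≡1)    → ⇒selfAndDualMaximum F (inj₁ size≡1)
        ; (inj₂ (n≡1 , _)) → ⇒selfAndDualMaximum F (inj₂ n≡1) }
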